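{- Among all bipartite distance-balanced graphs that are not cycles and are not $3$-connected, the minimum order is $18$; moreover, there is exactly one such graph of order $18$ up to isomorphism, namely $W(2,3)$.
   Context: All graphs are finite, simple, undirected, connected. For $u,v$ let $W_{uv}=\{z: d(u,z)<d(v,z)\}$; a connected graph is distance-balanced if $|W_{uv}|=|W_{vu}|$ for all adjacent $u,v$. A graph is $3$-connected if it has at least $4$ vertices and removing any at most $2$ vertices leaves it connected. $W(2,3)$ is the graph with vertex set $\{(i,j):0\le i\le 11,\ 1\le j\le f(i)\}$, where $f(i)=1$ if $i\equiv 0$ or $3\pmod 4$ and $f(i)=2$ otherwise, with $(i_1,j_1)\sim(i_2,j_2)$ iff $i_2-i_1\equiv\pm1\pmod{12}$.
   Formalization: The minimum-order claim is stated for graphs with at least 3 vertices, since the one-vertex graph and K2 are bipartite, distance-balanced, not cycles and not 3-connected, so the claim fails for them as literally stated. -}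

module Defs where

open import Data.Nat using (ℕ; zero; suc; _+_; _≤_; _<ᵇ_; _%_)
open import Data.Fin using (Fin; toℕ; _≟_)
open import Data.Bool using (Bool; true; false; if_then_else_; _∨_; _∧_)
open import Data.List using (List; allFin; filterᵇ; length)
open import Data.Bool.ListAction using (any)
open import Data.Product using (Σ; _×_)
open import Data.Sum using (_⊎_)
open import Data.Unit using (⊤)
open import Relation.Binary.PropositionalEquality using (_≡_; _≢_)
open import Relation.Nullary using (¬_)
open import Relation.Nullary.Decidable using (⌊_⌋)
open import Function.Bundles using (_↔_; Inverse; _⇔_)

record Graph (n : ℕ) : Set where
  field
    adj    : Fin n → Fin n → Bool
    sym    : ∀ u v → adj u v ≡ adj v u
    irrefl : ∀ u → adj u u ≡ false

open Graph public

module _ {n : ℕ} (G : Graph n) where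

  data WalkIn (ok : Fin n → Set) : Fin n → Fin n → Set where
    here : ∀ {u} → ok u → WalkIn ok u u
    step : ∀ {u w v} → ok u → adj G u w ≡ true → WalkIn ok w v → WalkIn ok u v

  Connected : Set
  Connected = ∀ u v → WalkIn (λ _ → ⊤) u v

  reach : ℕ → Fin n → Fin n → Bool
  reach zero    u v = ⌊ u ≟ v ⌋
  reach (suc k) u v = reach k u v ∨ any (λ w → adj G u w ∧ reach k w v) (allFin n)

  search : ℕ → ℕ → Fin n → Fin n → ℕ
  search zero     k u v = k
  search (suc f)  k u v = if reach k u v then k else search f (suc k) u v

  -- graph distance d(u,v) (the shortest walk length; equals n if unreachable)
  dist : Fin n → Fin n → ℕ
  dist u v = search n 0 u v

  cardW : Fin n → Fin n → ℕ
  cardW u v = length (filterᵇ (λ z → dist u z <ᵇ dist v z) (allFin n))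

  DistanceBalanced : Set
  DistanceBalanced = ∀ u v → adj G u v ≡ true → cardW u v ≡ cardW v u

  Bipartite : Set
  Bipartite = Σ (Fin n → Bool) λ c → ∀ u v → adj G u v ≡ true → c u ≢ c v

  IsoTo : (V : Set) → (V → V → Set) → Set
  IsoTo V R = Σ (Fin n ↔ V) λ e →
    ∀ u v → (adj G u v ≡ true) ⇔ R (Inverse.to e u) (Inverse.to e v)

CycSucc : (m : ℕ) → Fin m → Fin m → Set
CycSucc m i j = (suc (toℕ i) ≡ toℕ j) ⊎ ((suc (toℕ i) ≡ m) × (toℕ j ≡ 0))

CycAdj : (m : ℕ) → Fin m → Fin m → Set
CycAdj m i j = CycSucc m i j ⊎ CycSucc m j i

IsCycle : ∀ {n} → Graph n → Set
IsCycle {n} G = (3 ≤ n) × IsoTo G (Fin n) (CycAdj n)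

-- 3-connected: at least 4 vertices and removing any at most 2 vertices
-- (a and b, possibly equal; removing none = Connected) leaves it connected.
ThreeConnected : ∀ {n} → Graph n → Set
ThreeConnected {n} G =
  (4 ≤ n) × Connected G ×
  (∀ (a b u v : Fin n) → u ≢ a → u ≢ b → v ≢ a → v ≢ b →
     WalkIn G (λ x → (x ≢ a) × (x ≢ b)) u v)

-- the graph W(2,3): vertices (i,j), 0 ≤ i ≤ 11, 1 ≤ j ≤ f(i)
-- (j is represented by Fin (f i), i.e. shifted to start at 0)
fW : Fin 12 → ℕ
fW i with toℕ i % 4
... | 0 = 1
... | 3 = 1
... | _ = 2

W23V : Set
W23V = Σ (Fin 12) (λ i → Fin (fW i))

W23Adj : W23V → W23V → Set
W23Adj (i₁ Data.Product., _) (i₂ Data.Product., _) =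
  (toℕ i₂ ≡ (toℕ i₁ + 1) % 12) ⊎ (toℕ i₁ ≡ (toℕ i₂ + 1) % 12)

Admissible : ∀ {n} → Graph n → Set
Admissible G =
  Connected G × Bipartite G × DistanceBalanced G × ¬ IsCycle G × ¬ ThreeConnected G

{-# OPTIONS --safe #-}

-- In a bipartite distance-balanced graph with n = 2m vertices every edge uv has |W_uv| = m.
-- Let C be a union of components of G − {a, b} with |C| < m, and p, q the distances from a, b.
-- No edge rr′ with r in C can lower both p and q, as then W_rr′ ⊆ C; hence p + q = d(a, b) on C,
-- so C is a stack of layers between a and b, and outside C the vertices split into levels of p − q.
-- Counting W_xa for the neighbours x of a in C, and likewise at b, shows that the middle levels
-- together with the first and last layers of C number at most |C| + 2.
-- If |C| = m − 1, both sides of the cut are layered, the cut can be rotated around the graph, and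
-- G is a cycle. A vertex of degree two produces such a cut, so outside the cycles all degrees are
-- at least three and d(a, b) ≥ 3.
-- For C of minimal size all layers have at least two vertices, and a level with a single vertex t
-- yields new sides cut off by {a, t} and {b, t}. For n ≤ 18 this forces d(a, b) = 3, |C| = 4 and
-- two single-vertex levels t, t′. The inequality above for the sides cut off by {b, t} and {a, t′}
-- makes the layers next to b and a single vertices, so both contain a side of size 4; thus n = 18
-- and G is a ring of three copies of K₃,₃ minus an edge, which is W(2,3).
module Submission where

open import Defs renaming (sym to adj-sym; irrefl to adj-irrefl)
open import Data.Bool using (Bool; true; false; _∨_; _∧_; _xor_; not; T; T?; if_then_else_) renaming (_≟_ to _≟ᵇ_)
open import Data.Bool.ListAction using (any)
open import Data.Empty using (⊥; ⊥-elim)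
open import Data.Fin using (Fin; zero; suc; toℕ; fromℕ<; _≟_; punchOut)
open import Data.Fin.Patterns
open import Data.Fin.Properties using (any?; all?; injective⇒≤; punchOut-injective; toℕ-injective; toℕ<n; toℕ-fromℕ<)
open import Data.Fin.Subset using (Subset)
open import Data.Fin.Subset.Properties using (anySubset?)
open import Data.List using (List; []; _∷_; allFin; filter; length)
open import Data.List.Properties using (length-tabulate)
open import Data.List.Membership.Propositional using (_∈_)
open import Data.List.Membership.Propositional.Properties using (∈-filter⁺; ∈-filter⁻; ∈-allFin; ∈-length)
open import Data.List.Relation.Unary.All using ([]; _∷_)
open import Data.List.Relation.Unary.AllPairs using ([]; _∷_)
open import Data.List.Relation.Unary.Any using (here; there)
open import Data.List.Relation.Unary.Unique.Propositional using (Unique)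
import Data.List.Relation.Unary.Unique.Propositional.Properties as Uniq
open import Data.Nat using (ℕ; zero; suc; _+_; _*_; _∸_; _%_; _⊓_; ∣_-_∣; _≤_; _<_; _<ᵇ_; z≤n; s≤s; _≤?_; _<?_)
open import Data.Nat.Properties hiding (_≟_)
open import Data.Nat.Properties using () renaming (_≟_ to _≟ℕ_)
open import Data.Nat.Tactic.RingSolver using (solve-∀)
open import Data.Product using (Σ; ∃; _×_; _,_; proj₁; proj₂)
open import Data.Sum using (_⊎_; inj₁; inj₂; [_,_]′; map₁; map₂) renaming (map to map⊎)
open import Data.Unit using (⊤; tt)
open import Data.Vec using (lookup; tabulate; []; _∷_)
open import Data.Vec.Properties using (lookup∘tabulate)
open import Function using (_∘_; id; case_of_)
open import Function.Bundles using (_↔_; mk↔ₛ′; mk⇔; Inverse; Equivalence)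
open import Function.Construct.Composition using (_↔-∘_)
open import Level using (0ℓ)
open import Relation.Binary.Definitions using (tri<; tri≈; tri>)
open import Relation.Binary.PropositionalEquality using (_≡_; _≢_; refl; sym; trans; cong; cong₂; subst; subst₂; module ≡-Reasoning)
open import Relation.Nullary using (¬_; Dec; yes; no; contradiction)
open import Relation.Nullary.Decidable using (¬?; _×-dec_; _⊎-dec_; _→-dec_; dec-true; does; map′; from-yes; ⌊_⌋)
open import Relation.Unary using (Pred; Decidable)

-- Bipartiteness fixes the parity of p - q, and an edge changes p - q by at most two, so no edge
-- between vertices outside C jumps over a level of the right parity. This is what turns a
-- single-vertex level into a cut, and an empty level into a cut vertex, which is impossible because
-- the two gates of a side are at distance at least two. The number 18 comes from a trade-off for
-- minimal C. A level with one vertex t leaves three sets of at least |C| vertices besides a, b and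
-- t, so n is at least 3|C| + 3; levels with two or more vertices soon exceed the bound |C| + 2. The
-- lower bound and uniqueness both follow from one classification of the admissible graphs with 3 ≤
-- n ≤ 18. Its outcome is one-sided: a list of 18 vertices that exhausts the graph, with three
-- candidate neighbours each. Counting makes the entries distinct, and degree at least three makes
-- every candidate a neighbour.

-- Linear arithmetic by certificate: the equation is a semiring identity.
≤-by : ∀ {x y e f} z → x ≤ y → x + f ≡ z + (y + e) → e ≤ f
≤-by {x} {y} {e} {f} z x≤y eq = +-cancelˡ-≤ y e f (begin
  y + e        ≤⟨ m≤n+m (y + e) z ⟩
  z + (y + e)  ≡⟨ eq ⟨
  x + f        ≤⟨ +-monoˡ-≤ f x≤y ⟩
  y + f        ∎)
  where open ≤-Reasoning

⊥-by : ∀ {x y} z → x ≤ y → x ≡ suc (z + y) → ⊥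
⊥-by {x} {y} z x≤y eq = 1+n≰n (≤-trans (s≤s (m≤n+m y z)) (subst (_≤ y) eq x≤y))

-- A missed value `y` could be punched out, leaving an injection from `Fin (suc n)` into `Fin n`.
injective⇒surjective : ∀ {n} (f : Fin n → Fin n) → (∀ {x y} → f x ≡ f y → x ≡ y) → ∀ y → ∃ λ x → f x ≡ y
injective⇒surjective {suc n} f inj y with any? (λ x → f x ≟ y)
... | yes p = p
... | no ¬p = contradiction
  (injective⇒≤ {f = λ x → punchOut {i = y} {j = f x} (λ eq → ¬p (x , sym eq))}
    (λ eq → inj (punchOut-injective {i = y} (λ eq → ¬p (_ , sym eq)) (λ eq → ¬p (_ , sym eq)) eq))) 1+n≰n

-- Counting

module _ {A : Set} where

  length-filter-≤-∪ : {P Q R : Pred A 0ℓ} (P? : Decidable P) (Q? : Decidable Q) (R? : Decidable R) →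
    (∀ x → P x → Q x ⊎ R x) → ∀ xs →
    length (filter P? xs) ≤ length (filter Q? xs) + length (filter R? xs)
  length-filter-≤-∪ P? Q? R? f [] = z≤n
  length-filter-≤-∪ P? Q? R? f (x ∷ xs) with IH ← length-filter-≤-∪ P? Q? R? f xs | P? x | Q? x | R? x
  ... | no _  | no _  | no _  = IH
  ... | no _  | no _  | yes _ = ≤-trans IH (+-monoʳ-≤ _ (n≤1+n _))
  ... | no _  | yes _ | no _  = m≤n⇒m≤1+n IH
  ... | no _  | yes _ | yes _ = m≤n⇒m≤1+n (≤-trans IH (+-monoʳ-≤ _ (n≤1+n _)))
  ... | yes p | no _  | yes _ = ≤-trans (s≤s IH) (≤-reflexive (sym (+-suc _ _)))
  ... | yes p | yes _ | no _  = s≤s IH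
  ... | yes p | yes _ | yes _ = s≤s (≤-trans IH (+-monoʳ-≤ _ (n≤1+n _)))
  ... | yes p | no ¬q | no ¬r with f x p
  ...   | inj₁ q = contradiction q ¬q
  ...   | inj₂ r = contradiction r ¬r

  length-filter-∪-≤ : {P Q R : Pred A 0ℓ} (P? : Decidable P) (Q? : Decidable Q) (R? : Decidable R) →
    (∀ x → Q x → P x) → (∀ x → R x → P x) → (∀ x → Q x → R x → ⊥) → ∀ xs →
    length (filter Q? xs) + length (filter R? xs) ≤ length (filter P? xs)
  length-filter-∪-≤ P? Q? R? f g dis [] = z≤n
  length-filter-∪-≤ P? Q? R? f g dis (x ∷ xs) with IH ← length-filter-∪-≤ P? Q? R? f g dis xs | P? x | Q? x | R? x
  ... | _     | yes q | yes r = ⊥-elim (dis x q r)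
  ... | yes _ | yes _ | no _  = s≤s IH
  ... | yes _ | no _  | yes _ = ≤-trans (≤-reflexive (+-suc _ _)) (s≤s IH)
  ... | yes _ | no _  | no _  = m≤n⇒m≤1+n IH
  ... | no _  | no _  | no _  = IH
  ... | no ¬p | yes q | no _  = contradiction (f x q) ¬p
  ... | no ¬p | no _  | yes r = contradiction (g x r) ¬p

module _ {n : ℕ} where

  count : {P : Pred (Fin n) 0ℓ} → Decidable P → ℕ
  count P? = length (filter P? (allFin n))

  ∅? : Decidable {A = Fin n} (λ _ → ⊥)
  ∅? _ = no id

  module _ {P Q R : Pred (Fin n) 0ℓ} (P? : Decidable P) (Q? : Decidable Q) (R? : Decidable R) where

    count-≤-∪ : (∀ x → P x → Q x ⊎ R x) → count P? ≤ count Q? + count R?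
    count-≤-∪ f = length-filter-≤-∪ P? Q? R? f (allFin n)

    count-∪-≤ : (∀ x → Q x → P x) → (∀ x → R x → P x) → (∀ x → Q x → R x → ⊥) →
      count Q? + count R? ≤ count P?
    count-∪-≤ f g dis = length-filter-∪-≤ P? Q? R? f g dis (allFin n)

    count-≡-∪ : (∀ x → P x → Q x ⊎ R x) → (∀ x → Q x → P x) → (∀ x → R x → P x) →
      (∀ x → Q x → R x → ⊥) → count P? ≡ count Q? + count R?
    count-≡-∪ f g h dis = ≤-antisym (count-≤-∪ f) (count-∪-≤ g h dis)

  count-all : {P : Pred (Fin n) 0ℓ} (P? : Decidable P) → (∀ x → P x) → count P? ≡ n
  count-all P? f = trans (go (allFin n)) (length-tabulate id)
    where
    go : ∀ xs → length (filter P? xs) ≡ length xs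
    go [] = refl
    go (x ∷ xs) with P? x
    ... | yes _ = cong suc (go xs)
    ... | no ¬p = contradiction (f x) ¬p

  count-none : {P : Pred (Fin n) 0ℓ} (P? : Decidable P) → (∀ x → ¬ P x) → count P? ≡ 0
  count-none P? f = go (allFin n)
    where
    go : ∀ xs → length (filter P? xs) ≡ 0
    go [] = refl
    go (x ∷ xs) with P? x
    ... | yes p = contradiction p (f x)
    ... | no _  = go xs

  module _ {P Q : Pred (Fin n) 0ℓ} (P? : Decidable P) (Q? : Decidable Q) where

    count-mono : (∀ x → P x → Q x) → count P? ≤ count Q?
    count-mono f = ≤-trans (m≤m+n _ _)
      (count-∪-≤ Q? P? ∅? f (λ _ ()) (λ _ _ ()))

    count-cong : (∀ x → P x → Q x) → (∀ x → Q x → P x) → count P? ≡ count Q?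
    count-cong f g = ≤-antisym
      (count-mono f)
      (≤-trans (m≤m+n _ _) (count-∪-≤ P? Q? ∅? g (λ _ ()) (λ _ _ ())))

  module _ {P : Pred (Fin n) 0ℓ} (P? : Decidable P) where

    count-pos : ∀ {x} → P x → 1 ≤ count P?
    count-pos p = ∈-length (∈-filter⁺ P? (∈-allFin _) p)

    private
      elems : List (Fin n)
      elems = filter P? (allFin n)

      elems-unique : Unique elems
      elems-unique = Uniq.filter⁺ P? (Uniq.allFin⁺ n)

      ∈elems : ∀ {x} → P x → x ∈ elems
      ∈elems p = ∈-filter⁺ P? (∈-allFin _) p

      elems∈ : ∀ {x} → x ∈ elems → P x
      elems∈ x∈ = proj₂ (∈-filter⁻ P? {xs = allFin n} x∈)

    opaque
      count-witness : 1 ≤ count P? → ∃ P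
      count-witness 1≤ with elems | (λ {x} → elems∈ {x})
      count-witness () | [] | _
      ... | x ∷ xs | el = x , el (here refl)

    opaque
      count-unique : count P? ≤ 1 → ∀ {x y} → P x → P y → x ≡ y
      count-unique ≤1 {x} {y} px py with elems | ∈elems px | ∈elems py
      ... | _ ∷ [] | here refl | here refl = refl
      count-unique (s≤s ()) px py | _ ∷ _ ∷ _ | _ | _

    opaque
      count-two : count P? ≡ 2 → ∃ λ x → ∃ λ y → P x × P y × (∀ z → P z → z ≡ x ⊎ z ≡ y)
      count-two eq with elems | (λ {x} → elems∈ {x}) | (λ {x} → ∈elems {x})
      count-two refl | x ∷ y ∷ [] | el | le =
        x , y , el (here refl) , el (there (here refl)) , λ z pz → sort (le pz)
        where
        sort : ∀ {z} → z ∈ (x ∷ y ∷ []) → z ≡ x ⊎ z ≡ y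
        sort (here eq) = inj₁ eq
        sort (there (here eq)) = inj₂ eq

    opaque
      count-≤1 : (∀ {x y} → P x → P y → x ≡ y) → count P? ≤ 1
      count-≤1 uni with elems | (λ {x} → elems∈ {x}) | elems-unique
      ... | [] | _ | _ = z≤n
      ... | _ ∷ [] | _ | _ = s≤s z≤n
      ... | x ∷ y ∷ _ | el | (x≢y ∷ _) ∷ _ = contradiction (uni (el (here refl)) (el (there (here refl)))) x≢y

  count-singleton : ∀ v → count (_≟ v) ≡ 1
  count-singleton v = ≤-antisym
    (count-≤1 (_≟ v) (λ { refl refl → refl })) (count-pos (_≟ v) refl)

  _∖?_ : {P : Pred (Fin n) 0ℓ} → Decidable P → (v : Fin n) → Decidable (λ z → P z × z ≢ v)
  (P? ∖? v) z = P? z ×-dec ¬? (z ≟ v)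

  count-∖ : {P : Pred (Fin n) 0ℓ} (P? : Decidable P) {v : Fin n} → P v → count P? ≡ suc (count (P? ∖? v))
  count-∖ P? {v} pv = trans
    (count-≡-∪ P? (_≟ v) (P? ∖? v)
      (λ x px → case-≟ x px) (λ { _ refl → pv }) (λ _ → proj₁) (λ _ eq np → proj₂ np eq))
    (cong (_+ count (P? ∖? v)) (count-singleton v))
    where
    case-≟ : ∀ x → _ → x ≡ v ⊎ _ × x ≢ v
    case-≟ x px with x ≟ v
    ... | yes eq = inj₁ eq
    ... | no neq = inj₂ (px , neq)

-- Distances

∨-true : ∀ {x y} → x ∨ y ≡ true → x ≡ true ⊎ y ≡ true
∨-true {true}  _ = inj₁ refl
∨-true {false} p = inj₂ p

∧-true : ∀ {x y} → x ∧ y ≡ true → x ≡ true × y ≡ true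
∧-true {true} {true} _ = refl , refl

∨-trueʳ : ∀ x {y} → y ≡ true → x ∨ y ≡ true
∨-trueʳ true  _ = refl
∨-trueʳ false p = p

any-true⁻ : ∀ {A : Set} (f : A → Bool) xs → any f xs ≡ true → ∃ λ x → f x ≡ true
any-true⁻ f (x ∷ xs) p with ∨-true {f x} p
... | inj₁ q = x , q
... | inj₂ q = any-true⁻ f xs q

any-true⁺ : ∀ {A : Set} (f : A → Bool) {x xs} → x ∈ xs → f x ≡ true → any f xs ≡ true
any-true⁺ f (here refl) p rewrite p = refl
any-true⁺ f {xs = y ∷ _} (there x∈) p = ∨-trueʳ (f y) (any-true⁺ f x∈ p)

module _ {n : ℕ} (G : Graph n) where

  Reach : ℕ → Fin n → Fin n → Set
  Reach k u v = reach G k u v ≡ true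

  abstract

    reach-zero : ∀ {u v} → Reach 0 u v → u ≡ v
    reach-zero {u} {v} p with u ≟ v
    ... | yes eq = eq

    reach-refl : ∀ {u} → Reach 0 u u
    reach-refl {u} with u ≟ u
    ... | yes _  = refl
    ... | no neq = contradiction refl neq

    reach-suc : ∀ k {u v} → Reach k u v → Reach (suc k) u v
    reach-suc k p rewrite p = refl

    reach-mono : ∀ {j k u v} → j ≤ k → Reach j u v → Reach k u v
    reach-mono {j} {k} j≤k p with m≤n⇒m<n∨m≡n j≤k
    ... | inj₂ refl = p
    reach-mono {j} {suc k} j≤k p | inj₁ (s≤s j≤k′) = reach-suc k (reach-mono j≤k′ p)

    reach-step : ∀ k {u w v} → adj G u w ≡ true → Reach k w v → Reach (suc k) u v
    reach-step k {u} {w} {v} e p = ∨-trueʳ (reach G k u v)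
      (any-true⁺ _ (∈-allFin w) (cong₂ _∧_ e p))

    reach-split : ∀ k {u v} → Reach (suc k) u v →
      Reach k u v ⊎ ∃ λ w → adj G u w ≡ true × Reach k w v
    reach-split k {u} {v} p with ∨-true {reach G k u v} p
    ... | inj₁ q = inj₁ q
    ... | inj₂ q with w , r ← any-true⁻ _ (allFin n) q = inj₂ (w , ∧-true r)

    reach-trans : ∀ j {k u v w} → Reach j u v → Reach k v w → Reach (j + k) u w
    reach-trans zero    p q with refl ← reach-zero p = q
    reach-trans (suc j) {k} {u} {v} {w} p q with reach-split j p
    ... | inj₁ r = reach-suc (j + k) (reach-trans j {k} {u} {v} {w} r q)
    ... | inj₂ (x , e , r) = reach-step (j + k) e (reach-trans j {k} {x} {v} {w} r q)

    reach-adj : ∀ {u v} → adj G u v ≡ true → Reach 1 u v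
    reach-adj e = reach-step 0 e reach-refl

    reach-sym : ∀ k {u v} → Reach k u v → Reach k v u
    reach-sym zero    p with refl ← reach-zero p = reach-refl
    reach-sym (suc k) {u} {v} p with reach-split k p
    ... | inj₁ r = reach-suc k (reach-sym k r)
    ... | inj₂ (_ , e , r) = subst (λ i → Reach i v u) (+-comm k 1)
      (reach-trans k {1} (reach-sym k r) (reach-adj (trans (adj-sym G _ _) e)))

    walk⇒reach : ∀ {ok u v} → WalkIn G ok u v → ∃ λ k → Reach k u v
    walk⇒reach (here _) = 0 , reach-refl
    walk⇒reach (step _ e w) with k , p ← walk⇒reach w = suc k , reach-step k e p

  Exact : ℕ → Fin n → Fin n → Set
  Exact k u v = Reach k u v × (∀ {j} → Reach j u v → k ≤ j)

  abstract

    reach⇒exact : ∀ k {u v} → Reach k u v → ∃ λ j → Exact j u v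
    reach⇒exact zero p = 0 , p , λ _ → z≤n
    reach⇒exact (suc k) {u} {v} p with reach G k u v in eq
    ... | true = reach⇒exact k eq
    ... | false = suc k , reached , λ {j} q → ≰⇒> λ j≤k → contradiction (trans (sym eq) (reach-mono j≤k q)) λ ()
      where
      reached : Reach (suc k) u v
      reached = ∨-trueʳ (reach G k u v) p

    exact-step : ∀ k {u v} → Exact (suc k) u v → ∃ λ w → adj G u w ≡ true × Exact k w v
    exact-step k (p , min) with reach-split k p
    ... | inj₁ q = contradiction (min q) 1+n≰n
    ... | inj₂ (w , e , q) = w , e , q , λ {j} r → ≤-pred (min (reach-step j e r))

    exact-layer : ∀ k {u v} → Exact k u v → ∀ i → i ≤ k → ∃ λ w → Exact i w v
    exact-layer k ex i i≤k with m≤n⇒m<n∨m≡n i≤k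
    ... | inj₂ refl = _ , ex
    exact-layer (suc k) ex i i≤k | inj₁ (s≤s i≤k′) =
      exact-layer k (proj₂ (proj₂ (exact-step k ex))) i i≤k′

    -- a geodesic meets every distance layer of its endpoint, so its length is below n
    exact-< : ∀ {k u v} → Exact k u v → k < n
    exact-< {k} {u} {v} ex = injective⇒≤ {f = proj₁ ∘ layer} λ {i} {j} eq → toℕ-injective
      (≤-antisym (proj₂ (proj₂ (layer i)) (subst (λ w → Reach (toℕ j) w v) (sym eq) (proj₁ (proj₂ (layer j)))))
                 (proj₂ (proj₂ (layer j)) (subst (λ w → Reach (toℕ i) w v) eq (proj₁ (proj₂ (layer i))))))
      where
      layer : (i : Fin (suc k)) → ∃ λ w → Exact (toℕ i) w v
      layer i = exact-layer k ex (toℕ i) (≤-pred (toℕ<n i))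

    reach⇒reach-n : ∀ {k u v} → Reach k u v → Reach n u v
    reach⇒reach-n {k} p with j , ex ← reach⇒exact k p = reach-mono (<⇒≤ (exact-< ex)) (proj₁ ex)

    search-exact : ∀ {j u v} → Exact j u v → ∀ f k → k ≤ j → j ≤ k + f → search G f k u v ≡ j
    search-exact ex zero k k≤j j≤k = ≤-antisym k≤j (subst (_ ≤_) (+-identityʳ k) j≤k)
    search-exact {j} {u} {v} ex (suc f) k k≤j j≤k with reach G k u v in eq
    ... | true = ≤-antisym k≤j (proj₂ ex eq)
    ... | false = search-exact ex f (suc k)
      (≤∧≢⇒< k≤j λ { refl → contradiction (trans (sym eq) (proj₁ ex)) λ () })
      (subst (j ≤_) (+-suc k f) j≤k)

    -- `search` stops after n steps; by `exact-<` every shortest walk is shorter than that, so the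
    -- cutoff never shows.
    exact⇒dist : ∀ {j u v} → Exact j u v → dist G u v ≡ j
    exact⇒dist ex = search-exact ex n 0 z≤n (<⇒≤ (exact-< ex))

    module _ (D : Fin n → Fin n → ℕ)
      (D-refl : ∀ u → D u u ≡ 0)
      (D-lip : ∀ u w v → adj G u w ≡ true → D u v ≤ suc (D w v))
      (D-step : ∀ u v → u ≡ v ⊎ ∃ λ w → adj G u w ≡ true × D u v ≡ suc (D w v)) where

      private
        D-least : ∀ j {u v} → Reach j u v → D u v ≤ j
        D-least zero p with refl ← reach-zero p = ≤-reflexive (D-refl _)
        D-least (suc j) p with reach-split j p
        ... | inj₁ q = m≤n⇒m≤1+n (D-least j q)
        ... | inj₂ (w , e , q) = ≤-trans (D-lip _ w _ e) (s≤s (D-least j q))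

        D-reach : ∀ k {u v} → D u v ≡ k → Reach k u v
        D-reach k {u} {v} eq with D-step u v
        ... | inj₁ refl = reach-mono {0} {k} {u} z≤n reach-refl
        D-reach zero eq | inj₂ (w , e , p) = contradiction (trans (sym eq) p) λ ()
        D-reach (suc k) eq | inj₂ (w , e , p) = reach-step k e (D-reach k (suc-injective (trans (sym p) eq)))

      -- `D-lip` bounds `D` by the length of every walk, and `D-step` supplies a walk of length `D`.
      -- The distances in W(2,3) are certified in this way, because evaluating `dist` there would
      -- explore walks recursively.
      dist-char : ∀ u v → dist G u v ≡ D u v
      dist-char u v = exact⇒dist (D-reach _ refl , λ {j} → D-least j)

module Metric {n : ℕ} (G : Graph n) (conn : Connected G) where

  opaque
    -- A sealed copy of `dist`, so that goals never unfold into the search.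
    d : Fin n → Fin n → ℕ
    d = dist G

    d≡dist : ∀ u v → d u v ≡ dist G u v
    d≡dist _ _ = refl

  Adj : Fin n → Fin n → Set
  Adj u v = adj G u v ≡ true

  opaque
    d-exact : ∀ u v → Exact G (d u v) u v
    d-exact u v with k , p ← walk⇒reach G (conn u v) with j , ex ← reach⇒exact G k p =
      subst (λ i → Exact G i u v) (sym (trans (d≡dist u v) (exact⇒dist G ex))) ex

  opaque
    adj-swap : ∀ {u v} → Adj u v → Adj v u
    adj-swap e = trans (adj-sym G _ _) e

  opaque
    d-refl : ∀ u → d u u ≡ 0
    d-refl u = n≤0⇒n≡0 (proj₂ (d-exact u u) {0} (reach-refl G))

  opaque
    d-zero : ∀ {u v} → d u v ≡ 0 → u ≡ v
    d-zero {u} {v} eq = reach-zero G (subst (λ i → Reach G i u v) eq (proj₁ (d-exact u v)))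

  opaque
    d-pos : ∀ {u v} → u ≢ v → 1 ≤ d u v
    d-pos neq = n≢0⇒n>0 (neq ∘ d-zero)

  opaque
    d-sym : ∀ u v → d u v ≡ d v u
    d-sym u v = ≤-antisym (half u v) (half v u)
      where
      half : ∀ u v → d u v ≤ d v u
      half u v = proj₂ (d-exact u v) (reach-sym G (d v u) (proj₁ (d-exact v u)))

  opaque
    d-tri : ∀ u v w → d u w ≤ d u v + d v w
    d-tri u v w = proj₂ (d-exact u w) (reach-trans G (d u v) {d v w} (proj₁ (d-exact u v)) (proj₁ (d-exact v w)))

  opaque
    adj⇒≢ : ∀ {u v} → Adj u v → u ≢ v
    adj⇒≢ e refl = contradiction (trans (sym e) (adj-irrefl G _)) λ ()

  opaque
    adj⇒d≡1 : ∀ {u v} → Adj u v → d u v ≡ 1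
    adj⇒d≡1 {u} {v} e = ≤-antisym (proj₂ (d-exact u v) (reach-adj G e)) (d-pos (adj⇒≢ e))

  opaque
    d-step : ∀ u v {k} → d u v ≡ suc k → ∃ λ w → Adj u w × d w v ≡ k
    d-step u v eq with w , e , ex ← exact-step G _ (subst (λ i → Exact G i u v) eq (d-exact u v)) =
      w , e , trans (d≡dist w v) (exact⇒dist G ex)

  opaque
    d≡1⇒adj : ∀ {u v} → d u v ≡ 1 → Adj u v
    d≡1⇒adj {u} {v} eq with w , e , p ← d-step u v eq = subst (Adj u) (d-zero p) e

  opaque
    d-pred : ∀ v u {k} → d v u ≡ suc k → ∃ λ w → Adj u w × d v w ≡ k
    d-pred v u eq with w , e , p ← d-step u v (trans (d-sym u v) eq) = w , e , trans (d-sym v w) p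

  opaque
    d-lip : ∀ z {u v} → Adj u v → d z u ≤ suc (d z v)
    d-lip z {u} {v} e = begin
      d z u          ≤⟨ d-tri z v u ⟩
      d z v + d v u  ≡⟨ cong (d z v +_) (adj⇒d≡1 (adj-swap e)) ⟩
      d z v + 1      ≡⟨ +-comm _ 1 ⟩
      suc (d z v)    ∎
      where open ≤-Reasoning

-- Parity of distances in bipartite graphs.

par : ℕ → Bool
par zero    = false
par (suc k) = not (par k)

par-+ : ∀ j k → par (j + k) ≡ par j xor par k
par-+ zero    k = refl
par-+ (suc j) k rewrite par-+ j k with par j | par k
... | true  | true  = refl
... | true  | false = refl
... | false | true  = refl
... | false | false = refl

module BipartiteMetric {n : ℕ} (G : Graph n) (conn : Connected G) (bip : Bipartite G) where

  open Metric G conn public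

  V : Set
  V = Fin n

  col : V → Bool
  col = proj₁ bip

  col-step : ∀ {u v} → Adj u v → col u ≡ not (col v)
  col-step {u} {v} e with col u | col v | proj₂ bip u v e
  ... | true  | true  | neq = contradiction refl neq
  ... | true  | false | _   = refl
  ... | false | true  | _   = refl
  ... | false | false | neq = contradiction refl neq

  opaque
    par-d : ∀ u v → par (d u v) ≡ col u xor col v
    par-d u v = go (d u v) u refl
      where
      go : ∀ k u → d u v ≡ k → par k ≡ col u xor col v
      go zero u eq with refl ← d-zero eq with col u
      ... | true  = refl
      ... | false = refl
      go (suc k) u eq with w , e , p ← d-step u v eq
        rewrite go k w p | col-step e with col w | col v
      ... | true  | true  = refl
      ... | true  | false = refl
      ... | false | true  = refl
      ... | false | false = refl

  adj-d-≢ : ∀ {u v} z → Adj u v → d z u ≢ d z v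
  adj-d-≢ {u} {v} z e eq with trans (sym (par-d z u)) (trans (cong par eq) (par-d z v)) | col-step e
  ... | p | q rewrite q with col z | col v
  adj-d-≢ z e eq | () | q | true  | true
  adj-d-≢ z e eq | () | q | true  | false
  adj-d-≢ z e eq | () | q | false | true
  adj-d-≢ z e eq | () | q | false | false

  opaque
    adj-d : ∀ {u v} z → Adj u v → d z u ≡ suc (d z v) ⊎ d z v ≡ suc (d z u)
    adj-d {u} {v} z e with <-cmp (d z u) (d z v)
    ... | tri< lt _ _ = inj₂ (≤-antisym (d-lip z (adj-swap e)) lt)
    ... | tri≈ _ eq _ = contradiction eq (adj-d-≢ z e)
    ... | tri> _ _ gt = inj₁ (≤-antisym (d-lip z e) gt)

  closer? : ∀ u v → Decidable (λ z → d u z < d v z)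
  closer? u v z = d u z <? d v z

-- Cycles

CycSucc-injective : ∀ {k} {i j l : Fin k} → CycSucc k i j → CycSucc k l j → i ≡ l
CycSucc-injective (inj₁ p) (inj₁ q) = toℕ-injective (suc-injective (trans p (sym q)))
CycSucc-injective (inj₁ p) (inj₂ (_ , q)) = contradiction (trans p q) λ ()
CycSucc-injective (inj₂ (_ , p)) (inj₁ q) = contradiction (trans q p) λ ()
CycSucc-injective (inj₂ (p , _)) (inj₂ (q , _)) = toℕ-injective (suc-injective (trans p (sym q)))

CycSucc-functional : ∀ {k} {i j l : Fin k} → CycSucc k i j → CycSucc k i l → j ≡ l
CycSucc-functional (inj₁ p) (inj₁ q) = toℕ-injective (trans (sym p) q)
CycSucc-functional {j = j} (inj₁ p) (inj₂ (q , _)) = contradiction (toℕ<n j) (≤⇒≯ (≤-reflexive (trans (sym q) p)))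
CycSucc-functional {l = l} (inj₂ (p , _)) (inj₁ q) = contradiction (toℕ<n l) (≤⇒≯ (≤-reflexive (trans (sym p) q)))
CycSucc-functional (inj₂ (_ , p)) (inj₂ (_ , q)) = toℕ-injective (trans p (sym q))

CycAdj-pigeonhole : ∀ {k} {i j₁ j₂ j₃ : Fin k} → CycAdj k i j₁ → CycAdj k i j₂ → CycAdj k i j₃ →
  j₁ ≡ j₂ ⊎ j₁ ≡ j₃ ⊎ j₂ ≡ j₃
CycAdj-pigeonhole (inj₁ x) (inj₁ y) _        = inj₁ (CycSucc-functional x y)
CycAdj-pigeonhole (inj₂ x) (inj₂ y) _        = inj₁ (CycSucc-injective x y)
CycAdj-pigeonhole (inj₁ x) (inj₂ y) (inj₁ z) = inj₂ (inj₁ (CycSucc-functional x z))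
CycAdj-pigeonhole (inj₁ x) (inj₂ y) (inj₂ z) = inj₂ (inj₂ (CycSucc-injective y z))
CycAdj-pigeonhole (inj₂ x) (inj₁ y) (inj₁ z) = inj₂ (inj₂ (CycSucc-functional y z))
CycAdj-pigeonhole (inj₂ x) (inj₁ y) (inj₂ z) = inj₂ (inj₁ (CycSucc-injective x z))

CycAdj-sym : ∀ {k} {i j : Fin k} → CycAdj k i j → CycAdj k j i
CycAdj-sym (inj₁ x) = inj₂ x
CycAdj-sym (inj₂ x) = inj₁ x

injective⇒↔ : ∀ {n} (f : Fin n → Fin n) → (∀ {x y} → f x ≡ f y → x ≡ y) → Fin n ↔ Fin n
injective⇒↔ f inj = mk↔ₛ′ f (proj₁ ∘ sur) (proj₂ ∘ sur) (λ x → inj (proj₂ (sur (f x))))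
  where sur = injective⇒surjective f inj

-- Here `x`, `y`, `z` stand for the colours of a, b and a vertex, and `l` for the parity of an
-- offset. The two sides are the parities of p + k + 1 and q + l when k has the parity of l + d(a,
-- b).
xor-parity-mismatch : ∀ x y z l → not ((x xor z) xor (l xor (x xor y))) ≢ (y xor z) xor l
xor-parity-mismatch true  true  true  true  ()
xor-parity-mismatch true  true  true  false ()
xor-parity-mismatch true  true  false true  ()
xor-parity-mismatch true  true  false false ()
xor-parity-mismatch true  false true  true  ()
xor-parity-mismatch true  false true  false ()
xor-parity-mismatch true  false false true  ()
xor-parity-mismatch true  false false false ()
xor-parity-mismatch false true  true  true  ()
xor-parity-mismatch false true  true  false ()
xor-parity-mismatch false true  false true  ()
xor-parity-mismatch false true  false false ()
xor-parity-mismatch false false true  true  ()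
xor-parity-mismatch false false true  false ()
xor-parity-mismatch false false false true  ()
xor-parity-mismatch false false false false ()

par-double : ∀ k → par (k + k) ≡ false
par-double k rewrite par-+ k k with par k
... | true  = refl
... | false = refl

-- The graph W(2,3)

pattern 10F = suc 9F
pattern 11F = suc 10F
pattern 12F = suc 11F
pattern 13F = suc 12F
pattern 14F = suc 13F
pattern 15F = suc 14F
pattern 16F = suc 15F
pattern 17F = suc 16F

-- W(2,3) is cubic; its vertices (0,1), (1,1), (1,2), … , (11,1) are numbered
-- lexicographically, and N₁ i, N₂ i, N₃ i are the neighbours of vertex i.
N₁ N₂ N₃ : Fin 18 → Fin 18
N₁ = lookup (17F ∷ 0F ∷ 0F ∷ 5F ∷ 5F ∷ 6F ∷ 5F ∷ 6F ∷ 6F ∷ 11F ∷ 11F ∷ 12F ∷ 11F ∷ 12F ∷ 12F ∷ 17F ∷ 17F ∷ 0F ∷ [])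
N₂ = lookup (1F ∷ 3F ∷ 3F ∷ 1F ∷ 1F ∷ 3F ∷ 7F ∷ 9F ∷ 9F ∷ 7F ∷ 7F ∷ 9F ∷ 13F ∷ 15F ∷ 15F ∷ 13F ∷ 13F ∷ 15F ∷ [])
N₃ = lookup (2F ∷ 4F ∷ 4F ∷ 2F ∷ 2F ∷ 4F ∷ 8F ∷ 10F ∷ 10F ∷ 8F ∷ 8F ∷ 10F ∷ 14F ∷ 16F ∷ 16F ∷ 14F ∷ 14F ∷ 16F ∷ [])

Nbr : Fin 18 → Fin 18 → Set
Nbr i j = j ≡ N₁ i ⊎ j ≡ N₂ i ⊎ j ≡ N₃ i

Nbr? : ∀ i j → Dec (Nbr i j)
Nbr? i j = (j ≟ N₁ i) ⊎-dec (j ≟ N₂ i) ⊎-dec (j ≟ N₃ i)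

opaque
  Nbr-irrefl : ∀ i → ¬ Nbr i i
  Nbr-irrefl = from-yes (all? (λ i → ¬? (Nbr? i i)))

enc : Fin 18 → W23V
enc = lookup ((0F , 0F) ∷ (1F , 0F) ∷ (1F , 1F) ∷ (2F , 0F) ∷ (2F , 1F) ∷ (3F , 0F) ∷
              (4F , 0F) ∷ (5F , 0F) ∷ (5F , 1F) ∷ (6F , 0F) ∷ (6F , 1F) ∷ (7F , 0F) ∷
              (8F , 0F) ∷ (9F , 0F) ∷ (9F , 1F) ∷ (10F , 0F) ∷ (10F , 1F) ∷ (11F , 0F) ∷ [])

dec : W23V → Fin 18
dec (0F , 0F) = 0F
dec (1F , 0F) = 1F
dec (1F , 1F) = 2F
dec (2F , 0F) = 3F
dec (2F , 1F) = 4F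
dec (3F , 0F) = 5F
dec (4F , 0F) = 6F
dec (5F , 0F) = 7F
dec (5F , 1F) = 8F
dec (6F , 0F) = 9F
dec (6F , 1F) = 10F
dec (7F , 0F) = 11F
dec (8F , 0F) = 12F
dec (9F , 0F) = 13F
dec (9F , 1F) = 14F
dec (10F , 0F) = 15F
dec (10F , 1F) = 16F
dec (11F , 0F) = 17F

enc-dec : ∀ v → enc (dec v) ≡ v
enc-dec (0F , 0F) = refl
enc-dec (1F , 0F) = refl
enc-dec (1F , 1F) = refl
enc-dec (2F , 0F) = refl
enc-dec (2F , 1F) = refl
enc-dec (3F , 0F) = refl
enc-dec (4F , 0F) = refl
enc-dec (5F , 0F) = refl
enc-dec (5F , 1F) = refl
enc-dec (6F , 0F) = refl
enc-dec (6F , 1F) = refl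
enc-dec (7F , 0F) = refl
enc-dec (8F , 0F) = refl
enc-dec (9F , 0F) = refl
enc-dec (9F , 1F) = refl
enc-dec (10F , 0F) = refl
enc-dec (10F , 1F) = refl
enc-dec (11F , 0F) = refl

dec-enc : ∀ i → dec (enc i) ≡ i
dec-enc = from-yes (all? (λ i → dec (enc i) ≟ i))

Fin18↔W23V : Fin 18 ↔ W23V
Fin18↔W23V = mk↔ₛ′ enc dec enc-dec dec-enc

W23Adj? : ∀ u v → Dec (W23Adj u v)
W23Adj? (i , _) (j , _) = (toℕ j ≟ℕ (toℕ i + 1) % 12) ⊎-dec (toℕ i ≟ℕ (toℕ j + 1) % 12)

opaque
  Nbr⇒W23Adj : ∀ i j → Nbr i j → W23Adj (enc i) (enc j)
  Nbr⇒W23Adj = from-yes (all? (λ i → all? (λ j → Nbr? i j →-dec W23Adj? (enc i) (enc j))))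

  W23Adj⇒Nbr : ∀ i j → W23Adj (enc i) (enc j) → Nbr i j
  W23Adj⇒Nbr = from-yes (all? (λ i → all? (λ j → W23Adj? (enc i) (enc j) →-dec Nbr? i j)))

-- Deliberately one-sided: neither distinctness of the 18 vertices nor the presence of any edge is
-- asked for. When the graph has 18 vertices and no vertex has at most two neighbours, both can be
-- recovered.
record Layout {n : ℕ} (G : Graph n) : Set where
  field
    at   : Fin 18 → Fin n
    onto : ∀ z → ∃ λ i → at i ≡ z
    nbr  : ∀ i {w} → adj G (at i) w ≡ true → w ≡ at (N₁ i) ⊎ w ≡ at (N₂ i) ⊎ w ≡ at (N₃ i)

module _ (G : Graph 18) (L : Layout G)
  (degree-≥3 : ∀ {x u v} → u ≢ x → v ≢ x → (∀ w → adj G x w ≡ true → w ≡ u ⊎ w ≡ v) → ⊥) where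
  open Layout L

  private
    idx : Fin 18 → Fin 18
    idx z = proj₁ (onto z)

    at-idx : ∀ z → at (idx z) ≡ z
    at-idx z = proj₂ (onto z)

    idx-injective : ∀ {x y} → idx x ≡ idx y → x ≡ y
    idx-injective eq = trans (sym (at-idx _)) (trans (cong at eq) (at-idx _))

    at-injective : ∀ {i j} → at i ≡ at j → i ≡ j
    at-injective {i} {j} eq
      with x , refl ← injective⇒surjective idx idx-injective i
         | y , refl ← injective⇒surjective idx idx-injective j =
      cong idx (trans (sym (at-idx x)) (trans eq (at-idx y)))

    adj⇒Nbr : ∀ {i j} → adj G (at i) (at j) ≡ true → Nbr i j
    adj⇒Nbr {i} e with nbr i e
    ... | inj₁ eq = inj₁ (at-injective eq)
    ... | inj₂ (inj₁ eq) = inj₂ (inj₁ (at-injective eq))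
    ... | inj₂ (inj₂ eq) = inj₂ (inj₂ (at-injective eq))

    Nbr⇒≢ : ∀ {i j} → Nbr i j → at j ≢ at i
    Nbr⇒≢ {i} h eq with refl ← at-injective eq = Nbr-irrefl i h

    -- a missing neighbour would leave only two
    Nbr⇒adj : ∀ {i j} → Nbr i j → adj G (at i) (at j) ≡ true
    Nbr⇒adj {i} {j} h with adj G (at i) (at j) in eq
    ... | true = refl
    ... | false = ⊥-elim (missing h)
      where
      ¬e : ∀ {w} → adj G (at i) w ≡ true → w ≢ at j
      ¬e e refl = contradiction (trans (sym eq) e) λ ()

      missing : Nbr i j → ⊥
      missing (inj₁ refl) = degree-≥3 (Nbr⇒≢ (inj₂ (inj₁ refl))) (Nbr⇒≢ (inj₂ (inj₂ refl))) λ w e →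
        case nbr i e of λ { (inj₁ x) → contradiction x (¬e e) ; (inj₂ x) → x }
      missing (inj₂ (inj₁ refl)) = degree-≥3 (Nbr⇒≢ (inj₁ refl)) (Nbr⇒≢ (inj₂ (inj₂ refl))) λ w e →
        case nbr i e of λ { (inj₁ x) → inj₁ x ; (inj₂ (inj₁ x)) → contradiction x (¬e e) ; (inj₂ (inj₂ x)) → inj₂ x }
      missing (inj₂ (inj₂ refl)) = degree-≥3 (Nbr⇒≢ (inj₁ refl)) (Nbr⇒≢ (inj₂ (inj₁ refl))) λ w e →
        case nbr i e of λ { (inj₁ x) → inj₁ x ; (inj₂ (inj₁ x)) → inj₂ x ; (inj₂ (inj₂ x)) → contradiction x (¬e e) }

  layout⇒iso : IsoTo G W23V W23Adj
  layout⇒iso = (Fin18↔W23V ↔-∘ injective⇒↔ idx idx-injective) , λ u v → mk⇔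
    (λ e → Nbr⇒W23Adj (idx u) (idx v) (adj⇒Nbr (subst₂ (λ x y → adj G x y ≡ true) (sym (at-idx u)) (sym (at-idx v)) e)))
    (λ h → subst₂ (λ x y → adj G x y ≡ true) (at-idx u) (at-idx v) (Nbr⇒adj (W23Adj⇒Nbr (idx u) (idx v) h)))

-- Reachability after deleting two vertices.

does-sound : ∀ {P : Set} (P? : Dec P) → does P? ≡ true → P
does-sound (yes p) _ = p

module _ {n : ℕ} (G : Graph n) (a b : Fin n) where

  Ok : Fin n → Set
  Ok x = (x ≢ a) × (x ≢ b)

  ok? : Decidable Ok
  ok? x = ¬? (x ≟ a) ×-dec ¬? (x ≟ b)

  private
    ok : Fin n → Bool
    ok x = does (ok? x)

    ok-sound : ∀ {x} → ok x ≡ true → Ok x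
    ok-sound {x} = does-sound (ok? x)

    ∧-swap : ∀ {p q r s t} → p ≡ q → p ∧ (s ∧ t) ≡ r → q ∧ (t ∧ s) ≡ r
    ∧-swap {false} refl h = h
    ∧-swap {true} {s = false} {false} refl h = h
    ∧-swap {true} {s = false} {true} refl h = h
    ∧-swap {true} {s = true} {false} refl h = h
    ∧-swap {true} {s = true} {true} refl h = h

  -- The vertices `a` and `b` stay but become isolated, so the type of vertices is unchanged and
  -- `reach` still decides connectedness.
  delete : Graph n
  delete = record
    { adj = λ x y → adj G x y ∧ (ok x ∧ ok y)
    ; sym = λ x y → sym (∧-swap {s = ok x} {t = ok y} (adj-sym G x y) refl)
    ; irrefl = λ x → cong (_∧ (ok x ∧ ok x)) (adj-irrefl G x) }

  delete-adj : ∀ {x y} → adj delete x y ≡ true → adj G x y ≡ true × Ok y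
  delete-adj {x} {y} e with f , o ← ∧-true {adj G x y} e = f , ok-sound (proj₂ (∧-true {ok x} o))

  delete-adj⁺ : ∀ {x y} → adj G x y ≡ true → Ok x → Ok y → adj delete x y ≡ true
  delete-adj⁺ {x} {y} e ox oy = cong₂ _∧_ e (cong₂ _∧_ (dec-true (ok? x) ox) (dec-true (ok? y) oy))

  delete-walk : ∀ k {u v} → Ok u → Reach delete k u v → WalkIn G Ok u v
  delete-walk zero o r with refl ← reach-zero delete r = here o
  delete-walk (suc k) o r with reach-split delete k r
  ... | inj₁ r′ = delete-walk k o r′
  ... | inj₂ (w , e , r′) with f , ow ← delete-adj e = step o f (delete-walk k ow r′)

-- Cuts of size two

module Balanced {n : ℕ} (G : Graph n) (conn : Connected G) (bip : Bipartite G)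
  (m : ℕ) (n≡m+m : n ≡ m + m) (half : ∀ u v → adj G u v ≡ true → cardW G u v ≡ m) where

  open BipartiteMetric G conn bip public

  opaque
    count-closer : ∀ {u v} → Adj u v → count (closer? u v) ≡ m
    count-closer {u} {v} e = trans
      (count-cong (closer? u v) (λ z → T? (dist G u z <ᵇ dist G v z))
        (λ z lt → <⇒<ᵇ (subst₂ _<_ (d≡dist u z) (d≡dist v z) lt))
        (λ z lt → subst₂ _<_ (sym (d≡dist u z)) (sym (d≡dist v z)) (<ᵇ⇒< (dist G u z) (dist G v z) lt)))
      (half u v e)

  -- C is a union of components of G − {a, b} with fewer than half of the vertices;
  -- the case a = b of a cut vertex is allowed here and excluded by a≢b.
  record Side (a b : V) {C : Pred V 0ℓ} (C? : Decidable C) : Set where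
    field
      a∉       : ¬ C a
      b∉       : ¬ C b
      closed   : ∀ {r z} → C r → Adj r z → C z ⊎ z ≡ a ⊎ z ≡ b
      nonempty : ∃ C
      small    : count C? < m

  swap : ∀ {a b C} {C? : Decidable C} → Side a b C? → Side b a C?
  swap S = record
    { a∉ = b∉ ; b∉ = a∉ ; nonempty = nonempty ; small = small
    ; closed = λ c e → case (closed c e) of λ
        { (inj₁ c′) → inj₁ c′ ; (inj₂ (inj₁ eq)) → inj₂ (inj₂ eq) ; (inj₂ (inj₂ eq)) → inj₂ (inj₁ eq) } }
    where open Side S

  module SideProps {a b : V} {C : Pred V 0ℓ} {C? : Decidable C} (S : Side a b C?) where

    open Side S public

    p q : V → ℕ
    p = d a
    q = d b

    D : ℕ
    D = d a b

    Inside : V → Set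
    Inside r = C r ⊎ r ≡ a ⊎ r ≡ b

    via-a : ∀ r z → d r z ≤ p r + p z
    via-a r z = subst (λ k → d r z ≤ k + p z) (d-sym r a) (d-tri r a z)

    via-b : ∀ r z → d r z ≤ q r + q z
    via-b r z = subst (λ k → d r z ≤ k + q z) (d-sym r b) (d-tri r b z)

    opaque
      -- A geodesic that starts in `C` and ends outside has to leave through `a` or `b`; the
      -- induction follows it to that gate.
      gate : ∀ {r} → Inside r → ∀ {z} → ¬ C z → d r z ≡ p r + p z ⊎ d r z ≡ q r + q z
      gate {r} ins {z} z∉ = go (d r z) ins refl
        where
        go : ∀ k {r} → Inside r → d r z ≡ k → d r z ≡ p r + p z ⊎ d r z ≡ q r + q z
        go k (inj₂ (inj₁ refl)) eq = inj₁ (cong (_+ p z) (sym (d-refl a)))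
        go k (inj₂ (inj₂ refl)) eq = inj₂ (cong (_+ q z) (sym (d-refl b)))
        go zero (inj₁ c) eq with refl ← d-zero eq = contradiction c z∉
        go (suc k) {r} (inj₁ c) eq with w , e , wz ← d-step r z eq with go k (closed c e) wz
        ... | inj₁ h = inj₁ (≤-antisym (via-a r z)
          (≤-trans (+-monoˡ-≤ (p z) (d-lip a e)) (≤-reflexive (trans (cong suc (trans (sym h) wz)) (sym eq)))))
        ... | inj₂ h = inj₂ (≤-antisym (via-b r z)
          (≤-trans (+-monoˡ-≤ (q z) (d-lip b e)) (≤-reflexive (trans (cong suc (trans (sym h) wz)) (sym eq)))))

    -- otherwise everything closer to r than to r′ would lie in C, which is too small
    no-double-drop : ∀ {r r′} → C r → Adj r r′ → p r ≡ suc (p r′) → q r ≡ suc (q r′) → ⊥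
    no-double-drop {r} {r′} c e pr qr = <⇒≱ small (subst (_≤ count C?) (count-closer e)
      (count-mono (closer? r r′) C? inC))
      where
      inC : ∀ z → d r z < d r′ z → C z
      inC z lt with C? z
      ... | yes cz = cz
      ... | no z∉ with gate (inj₁ c) z∉
      ... | inj₁ h = contradiction lt (<⇒≯ (≤-trans (s≤s (via-a r′ z)) (≤-reflexive (sym (trans h (cong (_+ p z) pr))))))
      ... | inj₂ h = contradiction lt (<⇒≯ (≤-trans (s≤s (via-b r′ z)) (≤-reflexive (sym (trans h (cong (_+ q z) qr))))))

    opaque
      -- Induction along a geodesic to `a`: each step lowers `p`, so by `no-double-drop` it raises
      -- `q` and keeps the sum, which is D at `a`. The step cannot end in `b`, where `q` vanishes.
      layered : ∀ {r} → C r → p r + q r ≡ D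
      layered {r} c = go (p r) c refl
        where
        go : ∀ k {r} → C r → p r ≡ k → k + q r ≡ D
        go zero c eq with refl ← d-zero eq = contradiction c a∉
        go (suc k) {r} c eq with w , e , aw ← d-pred a r eq = by-next (adj-d b e) (closed c e)
          where
          by-next : q r ≡ suc (q w) ⊎ q w ≡ suc (q r) → Inside w → suc k + q r ≡ D
          by-next (inj₁ drop) _ = ⊥-elim (no-double-drop c e (trans eq (cong suc (sym aw))) drop)
          by-next (inj₂ rise) (inj₁ cw) = trans (sym (+-suc k (q r))) (trans (cong (k +_) (sym rise)) (go k cw aw))
          by-next (inj₂ rise) (inj₂ (inj₁ w≡a)) = 
            trans (cong (λ j → suc (j + q r)) k≡0) (trans (sym rise) (trans (cong q w≡a) (d-sym b a)))
            where
            k≡0 : k ≡ 0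
            k≡0 = trans (sym aw) (trans (cong p w≡a) (d-refl a))
          by-next (inj₂ rise) (inj₂ (inj₂ w≡b)) =
            contradiction (trans (sym rise) (trans (cong q w≡b) (d-refl b))) λ ()

    p-pos : ∀ {r} → C r → 1 ≤ p r
    p-pos c = d-pos λ { refl → a∉ c }

    q-pos : ∀ {r} → C r → 1 ≤ q r
    q-pos c = d-pos λ { refl → b∉ c }

    p<D : ∀ {r} → C r → p r < D
    p<D {r} c = subst (p r <_) (layered c) (subst (_< p r + q r) (+-identityʳ (p r)) (+-monoʳ-< (p r) (q-pos c)))

    2≤D : 2 ≤ D
    2≤D = ≤-trans (s≤s (p-pos (proj₂ nonempty))) (p<D (proj₂ nonempty))

    a≢b : a ≢ b
    a≢b eq = contradiction (subst (2 ≤_) (trans (cong (d a) (sym eq)) (d-refl a)) 2≤D) λ ()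

    opaque
      -- Both distances falling is `no-double-drop`; both rising would break `layered` inside `C`,
      -- and a gate is not farther from itself.
      edge : ∀ {r r′} → C r → Adj r r′ →
        (p r′ ≡ suc (p r) × q r ≡ suc (q r′)) ⊎ (p r ≡ suc (p r′) × q r′ ≡ suc (q r))
      edge {r} {r′} c e with adj-d a e | adj-d b e
      ... | inj₁ x | inj₁ y = ⊥-elim (no-double-drop c e x y)
      ... | inj₁ x | inj₂ y = inj₂ (x , y)
      ... | inj₂ x | inj₁ y = inj₁ (x , y)
      ... | inj₂ x | inj₂ y with closed c e
      ... | inj₁ c′ = ⊥-elim (⊥-by 1 (≤-reflexive (trans (layered c′) (sym (layered c))))
                        (trans (cong₂ _+_ x y) (cong suc (+-suc (p r) (q r)))))
      ... | inj₂ (inj₁ refl) = contradiction (trans (sym x) (d-refl a)) λ ()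
      ... | inj₂ (inj₂ refl) = contradiction (trans (sym y) (d-refl b)) λ ()

    opaque
      -- A geodesic to `a` stays in `C` until it arrives, since `b` is farther from `a` than every
      -- vertex of `C`.
      descend : ∀ {r} → C r → ∀ i → 1 ≤ i → i ≤ p r → ∃ λ z → C z × p z ≡ i
      descend {r} c i 1≤i i≤ = go (p r) c refl i≤
        where
        go : ∀ k {r} → C r → p r ≡ k → i ≤ k → ∃ λ z → C z × p z ≡ i
        go k {r} c eq i≤k with m≤n⇒m<n∨m≡n i≤k
        ... | inj₂ refl = r , c , eq
        go (suc k) {r} c eq i≤k | inj₁ (s≤s i≤k′) with w , e , aw ← d-pred a r eq with closed c e
        ... | inj₁ cw = go k cw aw i≤k′
        ... | inj₂ (inj₁ refl) with refl ← trans (sym aw) (d-refl a) = contradiction (≤-trans 1≤i i≤k′) λ ()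
        ... | inj₂ (inj₂ refl) = contradiction (subst (_< D) eq (p<D c)) (≤⇒≯ (≤-trans (≤-reflexive aw) (n≤1+n k)))

    Near : V → Set
    Near z = C z × p z ≡ 1

    Near? : Decidable Near
    Near? z = C? z ×-dec (p z ≟ℕ 1)

    opaque
      near : ∃ Near
      near = descend (proj₂ nonempty) 1 ≤-refl (p-pos (proj₂ nonempty))

    Far : V → Set
    Far z = ¬ C z × p z ≡ q z + D

    Far? : Decidable Far
    Far? z = ¬? (C? z) ×-dec (p z ≟ℕ q z + D)

    Far-b : Far b
    Far-b = b∉ , cong (_+ D) (sym (d-refl b))

    adj⇒Near : ∀ {z} → C z → Adj a z → Near z
    adj⇒Near c e = c , adj⇒d≡1 e

    opaque
      -- For `x` near `a`, the m vertices closer to `x` than to `a` include no other vertex of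
      -- `Near`. Those outside `C` are reached from `x` through `b`, which forces p = q + D.
      count-near : m + count Near? ≤ count C? + count Far? + 1
      count-near with x , cx , ax ← near = arith _ (count-∖ Near? (cx , ax))
          (subst (_≤ count W∩C? + count Far?) (count-closer (d≡1⇒adj (trans (d-sym x a) ax)))
            (count-≤-∪ (closer? x a) W∩C? Far? split))
          (count-∪-≤ C? W∩C? (Near? ∖? x) (λ _ → proj₂) (λ _ → proj₁ ∘ proj₁) disjoint)
        where
        W∩C? : Decidable (λ z → d x z < p z × C z)
        W∩C? z = closer? x a z ×-dec C? z

        split : ∀ z → d x z < p z → (d x z < p z × C z) ⊎ Far z
        split z lt with C? z
        ... | yes c = inj₁ (lt , c)
        ... | no z∉ with gate (inj₁ cx) z∉
        ... | inj₁ h = contradiction lt (<⇒≯ (subst (p z <_) (trans (cong (_+ p z) (sym ax)) (sym h)) ≤-refl))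
        ... | inj₂ h = inj₂ (z∉ , ≤-antisym
          (subst (p z ≤_) (+-comm D (q z)) (d-tri a b z))
          (subst (_≤ p z) (trans (cong suc (trans h (+-comm (q x) (q z))))
            (trans (sym (+-suc (q z) (q x))) (cong (q z +_) (trans (cong (_+ q x) (sym ax)) (layered cx))))) lt))

        disjoint : ∀ z → d x z < p z × C z → Near z × z ≢ x → ⊥
        disjoint z (lt , _) ((_ , az) , z≢x) =
          z≢x (sym (d-zero (n≤0⇒n≡0 (≤-pred (subst (d x z <_) az lt)))))

        arith : ∀ {w l c f l′} m → l ≡ suc l′ → m ≤ w + f → w + l′ ≤ c → m + l ≤ c + f + 1
        arith {w} {l} {c} {f} {l′} m refl h₁ h₂ = ≤-by 0 (+-mono-≤ h₁ h₂) (eq m w l′ c f)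
          where
          eq : ∀ m w l′ c f → (m + (w + l′)) + (c + f + 1) ≡ (w + f + c) + (m + suc l′)
          eq = solve-∀

  no-cut-vertex : ∀ {a C} {C? : Decidable C} → Side a a C? → ⊥
  no-cut-vertex S = SideProps.a≢b S refl

  opaque
    count-∁ : ∀ {C : Pred V 0ℓ} (C? : Decidable C) → count C? + count (λ z → ¬? (C? z)) ≡ m + m
    count-∁ {C} C? = trans (sym (count-≡-∪ univ? C? (λ z → ¬? (C? z)) split _ _ (λ _ c ¬c → ¬c c)))
                      (trans (count-all univ? _) n≡m+m)
      where
      univ? : Decidable {A = V} (λ _ → ⊤)
      univ? _ = yes tt

      split : ∀ z → ⊤ → C z ⊎ ¬ C z
      split z _ with C? z
      ... | yes c = inj₁ c
      ... | no ¬c = inj₂ ¬c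

  module TwoSided {a b : V} {C : Pred V 0ℓ} {C? : Decidable C} (S : Side a b C?) where

    open SideProps S public
    module Op = SideProps (swap S)

    Mid : V → Set
    Mid z = ¬ C z × ¬ Far z × ¬ Op.Far z

    Mid? : Decidable Mid
    Mid? z = ¬? (C? z) ×-dec ¬? (Far? z) ×-dec ¬? (Op.Far? z)

    far-disjoint : ∀ {z} → Far z → Op.Far z → ⊥
    far-disjoint {z} (_ , x) (_ , y) = contradiction (≤-trans 2≤D (≤-trans (m≤n+m D (d b a)) (≤-reflexive zero-sum))) λ ()
      where
      zero-sum : d b a + D ≡ 0
      zero-sum = +-cancelˡ-≡ (p z) _ _ (begin
        p z + (d b a + D)  ≡⟨ +-assoc (p z) (d b a) D ⟨
        p z + d b a + D    ≡⟨ cong (_+ D) y ⟨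
        q z + D            ≡⟨ x ⟨
        p z                ≡⟨ +-identityʳ (p z) ⟨
        p z + 0            ∎)
        where open ≡-Reasoning

    opaque
      count-mid : count C? + (count Far? + (count Op.Far? + count Mid?)) ≡ m + m
      count-mid = trans (cong (count C? +_) (sym (trans
          (count-≡-∪ ∁? Far? rest? (λ z c → split-far z c) (λ _ → proj₁) (λ _ → proj₁) (λ _ f r → proj₂ r f))
          (cong (count Far? +_)
            (count-≡-∪ rest? Op.Far? Mid? (λ z → split-op z) (λ z f → proj₁ f , λ g → far-disjoint g f)
              (λ _ r → proj₁ r , proj₁ (proj₂ r)) (λ _ f r → proj₂ (proj₂ r) f)))))) (count-∁ C?)
        where
        ∁? : Decidable (λ z → ¬ C z)
        ∁? z = ¬? (C? z)

        rest? : Decidable (λ z → ¬ C z × ¬ Far z)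
        rest? z = ∁? z ×-dec ¬? (Far? z)

        split-far : ∀ z → ¬ C z → Far z ⊎ (¬ C z × ¬ Far z)
        split-far z c with Far? z
        ... | yes f = inj₁ f
        ... | no ¬f = inj₂ (c , ¬f)

        split-op : ∀ z → ¬ C z × ¬ Far z → Op.Far z ⊎ Mid z
        split-op z (c , ¬f) with Op.Far? z
        ... | yes f = inj₁ f
        ... | no ¬g = inj₂ (c , ¬f , ¬g)

    opaque
      -- Adding `count-near` for both gates and subtracting the partition of all 2m vertices
      -- eliminates m and both far sets.
      count-mid-near : count Mid? + count Near? + count Op.Near? ≤ count C? + 2
      count-mid-near = arith m (count C?) (count Far?) (count Op.Far?) (count Mid?) (count Near?) (count Op.Near?)
        count-near Op.count-near count-mid
        where
        arith : ∀ m c f g k l l′ → m + l ≤ c + f + 1 → m + l′ ≤ c + g + 1 → c + (f + (g + k)) ≡ m + m →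
          k + l + l′ ≤ c + 2
        arith m c f g k l l′ h₁ h₂ eq = ≤-by 0 (+-mono-≤ (+-mono-≤ h₁ h₂) (≤-reflexive eq)) (id₁ m c f g k l l′)
          where
          id₁ : ∀ m c f g k l l′ → ((m + l) + (m + l′)) + (c + (f + (g + k))) + (c + 2)
            ≡ (((c + f + 1) + (c + g + 1)) + (m + m)) + (k + l + l′)
          id₁ = solve-∀

    opaque
      layer : ∀ i → 1 ≤ i → i < D → ∃ λ z → C z × p z ≡ i
      layer i 1≤i i<D with r , c ← nonempty with ≤-total i (p r)
      ... | inj₁ i≤ = descend c i 1≤i i≤
      ... | inj₂ ≥i with z , cz , qz ← Op.descend c (D ∸ i) (m<n⇒0<n∸m i<D)
               (≤-trans (∸-monoʳ-≤ D ≥i) (≤-reflexive (trans (cong (_∸ p r) (sym (layered c))) (m+n∸m≡n (p r) (q r))))) =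
        z , cz , (begin
          p z                ≡⟨ m+n∸n≡m (p z) (q z) ⟨
          p z + q z ∸ q z    ≡⟨ cong₂ _∸_ (layered cz) qz ⟩
          D ∸ (D ∸ i)        ≡⟨ m∸[m∸n]≡n (<⇒≤ i<D) ⟩
          i                  ∎)
        where open ≡-Reasoning

    Co : V → Set
    Co z = ¬ C z × z ≢ a × z ≢ b

    Co? : Decidable Co
    Co? z = ¬? (C? z) ×-dec ¬? (z ≟ a) ×-dec ¬? (z ≟ b)

    opaque
      count-Co : count C? + (2 + count Co?) ≡ m + m
      count-Co = trans (cong (count C? +_) (sym (trans (count-∖ ∁? a∉)
          (cong suc (trans (count-∖ (∁? ∖? a) (b∉ , a≢b ∘ sym))
            (cong suc (count-cong _ Co? (λ _ r → proj₁ (proj₁ r) , proj₂ (proj₁ r) , proj₂ r)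
              (λ _ r → (proj₁ r , proj₁ (proj₂ r)) , proj₂ (proj₂ r)))))))))
        (count-∁ C?)
        where
        ∁? : Decidable (λ z → ¬ C z)
        ∁? z = ¬? (C? z)

    data Place (z : V) : Set where
      in-C  : C z → Place z
      at-a  : z ≡ a → Place z
      at-b  : z ≡ b → Place z
      in-Co : Co z → Place z

    place : ∀ z → Place z
    place z with C? z | z ≟ a | z ≟ b
    ... | yes c | _      | _      = in-C c
    ... | no _  | yes eq | _      = at-a eq
    ... | no _  | no _   | yes eq = at-b eq
    ... | no c  | no ≢a  | no ≢b  = in-Co (c , ≢a , ≢b)

    Co-closed : ∀ {r z} → Co r → Adj r z → Co z ⊎ z ≡ a ⊎ z ≡ b
    Co-closed {r} {z} (r∉ , r≢a , r≢b) e with place z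
    ... | at-a eq = inj₂ (inj₁ eq)
    ... | at-b eq = inj₂ (inj₂ eq)
    ... | in-Co c = inj₁ c
    ... | in-C c with closed c (adj-swap e)
    ...   | inj₁ cr = contradiction cr r∉
    ...   | inj₂ (inj₁ eq) = contradiction eq r≢a
    ...   | inj₂ (inj₂ eq) = contradiction eq r≢b

    ¬adj-ab : ¬ Adj a b
    ¬adj-ab e = contradiction (subst (2 ≤_) (adj⇒d≡1 e) 2≤D) λ { (s≤s ()) }

  -- Sides with m - 1 vertices: the graph is a cycle.

  -- Only one gate is an index, because the property carried along edges is that of being a gate of
  -- some cut into two sets of m - 1 vertices.
  record BigSide (a : V) : Set₁ where
    field
      {b}  : V
      {C}  : Pred V 0ℓ
      {C?} : Decidable C
      side : Side a b C?
      full : suc (count C?) ≡ m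

  module _ {a b : V} {C : Pred V 0ℓ} {C? : Decidable C} (S : Side a b C?) (full : suc (count C?) ≡ m) where
    open TwoSided S

    opaque
      count-Co-full : suc (count Co?) ≡ m
      count-Co-full = +-cancelˡ-≡ m _ _ (trans (cong (_+ suc (count Co?)) (sym full))
        (trans (sym (+-suc (count C?) (suc (count Co?)))) count-Co))

    coSide : Side a b Co?
    coSide = record
      { a∉ = λ c → proj₁ (proj₂ c) refl
      ; b∉ = λ c → proj₂ (proj₂ c) refl
      ; closed = Co-closed
      ; nonempty = count-witness Co? (subst (1 ≤_) (suc-injective (trans full (sym count-Co-full)))
                     (count-pos C? (proj₂ nonempty)))
      ; small = ≤-reflexive count-Co-full }

    opaque
      -- The complement is a side too, hence p < D on it and `b` is the only far vertex. Then
      -- `count-near` reads m + |Near| ≤ (m - 1) + 1 + 1.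
      full⇒near-unique : ∀ {x y} → C x → Adj a x → C y → Adj a y → x ≡ y
      full⇒near-unique cx ax cy ay = count-unique Near? near≤1 (adj⇒Near cx ax) (adj⇒Near cy ay)
        where
        far⇒b : ∀ {z} → Far z → z ≡ b
        far⇒b {z} (z∉ , eq) with place z
        ... | in-C c = contradiction c z∉
        ... | at-b eq′ = eq′
        ... | at-a refl = contradiction (≤-trans 2≤D (≤-trans (m≤n+m D (q a))
                (≤-reflexive (trans (sym eq) (d-refl a))))) λ ()
        ... | in-Co c = contradiction (SideProps.p<D coSide c) (≤⇒≯ (≤-trans (m≤n+m D (q z)) (≤-reflexive (sym eq))))

        near≤1 : count Near? ≤ 1
        near≤1 = ≤-by 0 (≤-trans count-near (+-monoˡ-≤ 1 (+-monoʳ-≤ (count C?)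
            (count-≤1 Far? (λ f g → trans (far⇒b f) (sym (far⇒b g)))))))
          (trans (cong (λ k → k + count Near? + 1) (sym full)) (id₁ (count C?) (count Near?)))
          where
          id₁ : ∀ c k → suc c + k + 1 ≡ 0 + (c + 1 + 1 + k)
          id₁ = solve-∀

  module _ {a b : V} {C : Pred V 0ℓ} {C? : Decidable C} (S : Side a b C?) (full : suc (count C?) ≡ m) where
    open TwoSided S

    -- both gates move one step: C loses y and gains b
    rotate : ∀ {y} → C y → Adj a y → BigSide y
    rotate {y} cy ay = record { side = record
        { a∉ = λ { (inj₁ (_ , neq)) → neq refl ; (inj₂ refl) → b∉ cy }
        ; b∉ = λ { (inj₁ (c , _)) → proj₁ cb′ c ; (inj₂ eq) → proj₂ (proj₂ cb′) eq }
        ; closed = closed′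
        ; nonempty = b , inj₂ refl
        ; small = subst (_≤ m) (cong suc (sym count-N)) small }
      ; full = trans (cong suc count-N) full }
      where
      module O = SideProps (swap (coSide S full))
      -- The new second gate is the only neighbour of `b` on the other side of the cut.
      b′ = proj₁ O.near
      cb′ = proj₁ (proj₂ O.near)
      bb′ = d≡1⇒adj (proj₂ (proj₂ O.near))

      N : V → Set
      N z = (C z × z ≢ y) ⊎ z ≡ b

      N? : Decidable N
      N? z = (C? ∖? y) z ⊎-dec (z ≟ b)

      count-N : count N? ≡ count C?
      count-N = trans (count-≡-∪ N? (_≟ b) (C? ∖? y) (λ { _ (inj₁ x) → inj₂ x ; _ (inj₂ x) → inj₁ x })
          (λ _ → inj₂) (λ _ → inj₁) (λ { _ refl (c , _) → b∉ c }))
        (trans (cong (_+ count (C? ∖? y)) (count-singleton b)) (sym (count-∖ C? cy)))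

      to-N : ∀ {w} → C w → N w ⊎ w ≡ y ⊎ w ≡ b′
      to-N {w} c with w ≟ y
      ... | yes eq = inj₂ (inj₁ eq)
      ... | no neq = inj₁ (inj₁ (c , neq))

      closed′ : ∀ {z w} → N z → Adj z w → N w ⊎ w ≡ y ⊎ w ≡ b′
      closed′ (inj₁ (c , neq)) e with closed c e
      ... | inj₁ cw = to-N cw
      ... | inj₂ (inj₁ refl) = contradiction (full⇒near-unique S full c (adj-swap e) cy ay) neq
      ... | inj₂ (inj₂ eq) = inj₁ (inj₂ eq)
      closed′ {w = w} (inj₂ refl) e with place w
      ... | in-C cw = to-N cw
      ... | at-a refl = contradiction (adj-swap e) ¬adj-ab
      ... | at-b eq = inj₁ (inj₂ eq)
      ... | in-Co cw = inj₂ (inj₂ (full⇒near-unique (swap (coSide S full)) (count-Co-full S full) cw e cb′ bb′))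

  bigSide-step : ∀ {x y} → BigSide x → Adj x y → BigSide y
  bigSide-step {y = y} B e with TwoSided.place side y
    where open BigSide B
  ... | TwoSided.in-C c = rotate (BigSide.side B) (BigSide.full B) c e
  ... | TwoSided.at-a refl = contradiction refl (adj⇒≢ e)
  ... | TwoSided.at-b refl = contradiction e (TwoSided.¬adj-ab (BigSide.side B))
  ... | TwoSided.in-Co c = rotate (coSide side full) (count-Co-full side full) c e
    where open BigSide B

  bigSide-everywhere : ∀ {x} → BigSide x → ∀ y → BigSide y
  bigSide-everywhere {x} B y = go B (conn x y)
    where
    go : ∀ {x} → BigSide x → WalkIn G (λ _ → ⊤) x y → BigSide y
    go B (here _) = B
    go B (step _ e w) = go (bigSide-step B e) w

  opaque
    -- A gate has at most one neighbour on each side of its cut, and it is not adjacent to the other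
    -- gate.
    bigSide⇒deg≤2 : ∀ {x} → BigSide x → ∀ {u v w} → Adj x u → Adj x v → Adj x w → u ≡ v ⊎ u ≡ w ⊎ v ≡ w
    bigSide⇒deg≤2 {x} B {u} {v} {w} xu xv xw = pigeon (which xu) (which xv) (which xw)
      where
      open BigSide B
      open TwoSided side using (Co; place; in-C; at-a; at-b; in-Co; ¬adj-ab)

      which : ∀ {u} → Adj x u → C u ⊎ Co u
      which {u} e with place u
      ... | in-C c = inj₁ c
      ... | at-a refl = contradiction refl (adj⇒≢ e)
      ... | at-b refl = contradiction e ¬adj-ab
      ... | in-Co c = inj₂ c

      C-uniq : ∀ {u v} → C u → C v → Adj x u → Adj x v → u ≡ v
      C-uniq cu cv xu xv = full⇒near-unique side full cu xu cv xv

      Co-uniq : ∀ {u v} → Co u → Co v → Adj x u → Adj x v → u ≡ v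
      Co-uniq cu cv xu xv = full⇒near-unique (coSide side full) (count-Co-full side full) cu xu cv xv

      pigeon : C u ⊎ Co u → C v ⊎ Co v → C w ⊎ Co w → u ≡ v ⊎ u ≡ w ⊎ v ≡ w
      pigeon (inj₁ i) (inj₁ j) _        = inj₁ (C-uniq i j xu xv)
      pigeon (inj₂ i) (inj₂ j) _        = inj₁ (Co-uniq i j xu xv)
      pigeon (inj₁ i) (inj₂ j) (inj₁ k) = inj₂ (inj₁ (C-uniq i k xu xw))
      pigeon (inj₁ i) (inj₂ j) (inj₂ k) = inj₂ (inj₂ (Co-uniq j k xv xw))
      pigeon (inj₂ i) (inj₁ j) (inj₁ k) = inj₂ (inj₂ (C-uniq j k xv xw))
      pigeon (inj₂ i) (inj₁ j) (inj₂ k) = inj₂ (inj₁ (Co-uniq i k xu xw))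

  module _ {a b : V} {C : Pred V 0ℓ} {C? : Decidable C} (S : Side a b C?) (full : suc (count C?) ≡ m) where
    open TwoSided S

    opaque
      -- Induction on the layer: the predecessors of the two vertices coincide in some `r`, which
      -- has degree at most two and spends one neighbour in the direction of `a`.
      full⇒layer-unique : ∀ {z z′} → C z → C z′ → p z ≡ p z′ → z ≡ z′
      full⇒layer-unique {z} {z′} c c′ eq with p z in pz | p-pos c
      ... | suc k | _ = go k c c′ pz (sym eq)
        where
        pred-in-C : ∀ {z w k} → C z → Adj z w → p z ≡ suc (suc k) → p w ≡ suc k → C w
        pred-in-C c e pz pw with closed c e
        ... | inj₁ cw = cw
        ... | inj₂ (inj₁ refl) = contradiction (trans (sym pw) (d-refl a)) λ ()
        ... | inj₂ (inj₂ refl) = contradiction (p<D c) (≤⇒≯ (subst₂ _≤_ (sym pw) (sym pz) (n≤1+n _)))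

        go : ∀ k {z z′} → C z → C z′ → p z ≡ suc k → p z′ ≡ suc k → z ≡ z′
        go zero c c′ pz pz′ = full⇒near-unique S full c (d≡1⇒adj pz) c′ (d≡1⇒adj pz′)
        go (suc k) {z} {z′} c c′ pz pz′
          with r , e , pr ← d-pred a z pz | r′ , e′ , pr′ ← d-pred a z′ pz′
          with refl ← go k (pred-in-C c e pz pr) (pred-in-C c′ e′ pz′ pr′) pr pr′
          with s , f , ps ← d-pred a r pr
          with bigSide⇒deg≤2 (bigSide-everywhere (record { side = S ; full = full }) r) f (adj-swap e) (adj-swap e′)
        ... | inj₁ refl = ⊥-elim (⊥-by 1 (≤-reflexive (trans (sym pz) ps)) refl)
        ... | inj₂ (inj₁ refl) = ⊥-elim (⊥-by 1 (≤-reflexive (trans (sym pz′) ps)) refl)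
        ... | inj₂ (inj₂ eq) = eq

    opaque
      -- The layers 1, ..., D - 1 are single vertices, so |C| = D - 1.
      full⇒m≡D : m ≡ D
      full⇒m≡D = trans (sym full) (go D≡ refl)
        where
        D≡ : ∃ λ k → D ≡ suc k
        D≡ with D | 2≤D
        ... | suc k | _ = k , refl

        below? : ∀ i → Decidable (λ z → C z × p z ≤ i)
        below? i z = C? z ×-dec (p z ≤? i)

        at? : ∀ i → Decidable (λ z → C z × p z ≡ i)
        at? i z = C? z ×-dec (p z ≟ℕ i)

        count-below : ∀ i → i < D → count (below? i) ≡ i
        count-below zero _ = count-none (below? 0) λ { z (c , le) → <⇒≱ (p-pos c) le }
        count-below (suc i) i<D = trans
          (count-≡-∪ (below? (suc i)) (at? (suc i)) (below? i) split
            (λ _ r → proj₁ r , ≤-reflexive (proj₂ r)) (λ _ r → proj₁ r , m≤n⇒m≤1+n (proj₂ r))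
            (λ { _ (_ , eq) (_ , le) → 1+n≰n (subst (_≤ i) eq le) }))
          (cong₂ _+_ (≤-antisym (count-≤1 (at? (suc i)) λ { (c , x) (c′ , y) → full⇒layer-unique c c′ (trans x (sym y)) })
                                (count-pos (at? (suc i)) (proj₂ (layer (suc i) (s≤s z≤n) i<D))))
                     (count-below i (<-trans (n<1+n i) i<D)))
          where
          split : ∀ z → C z × p z ≤ suc i → (C z × p z ≡ suc i) ⊎ (C z × p z ≤ i)
          split z (c , le) with m≤n⇒m<n∨m≡n le
          ... | inj₁ (s≤s le′) = inj₂ (c , le′)
          ... | inj₂ eq = inj₁ (c , eq)

        go : (∃ λ k → D ≡ suc k) → ∀ {e} → e ≡ D → suc (count C?) ≡ e
        go (k , D≡1+k) refl = trans (cong suc (trans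
          (count-cong C? (below? k) (λ z c → c , ≤-pred (subst (p z <_) D≡1+k (p<D c))) (λ _ → proj₁))
          (count-below k (≤-reflexive (sym D≡1+k))))) (sym D≡1+k)

  module FullCycle {a b : V} {C : Pred V 0ℓ} {C? : Decidable C} (S : Side a b C?) (full : suc (count C?) ≡ m) where
    open TwoSided S
    module O = TwoSided (coSide S full)

    n≡D+D : n ≡ D + D
    n≡D+D = trans n≡m+m (cong₂ _+_ (full⇒m≡D S full) (full⇒m≡D S full))

    -- Position on the cycle: 0 at `a`, then the layers of `C`, D at `b`, and the other half counted
    -- backwards from n = 2D.
    pos : V → ℕ
    pos z with Co? z
    ... | yes _ = n ∸ p z
    ... | no _  = p z

    p≤D : ∀ {z} → ¬ Co z → p z ≤ D
    p≤D {z} z∉ with place z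
    ... | in-C c = <⇒≤ (p<D c)
    ... | at-a refl = ≤-trans (≤-reflexive (d-refl a)) z≤n
    ... | at-b refl = ≤-refl
    ... | in-Co c = contradiction c z∉

    pos-outer : ∀ {z} → ¬ Co z → pos z ≡ p z
    pos-outer {z} z∉ with Co? z
    ... | yes c = contradiction c z∉
    ... | no _  = refl

    D≤n : D ≤ n
    D≤n = subst (D ≤_) (sym n≡D+D) (m≤m+n D D)

    pos-inner : ∀ {z} → Co z → pos z + p z ≡ n
    pos-inner {z} c with Co? z
    ... | yes _ = m∸n+n≡m (≤-trans (<⇒≤ (O.p<D c)) D≤n)
    ... | no z∉ = contradiction c z∉

    pos-inner->D : ∀ {z} → Co z → D < pos z
    pos-inner->D {z} c = +-cancelʳ-< (p z) D (pos z)
      (subst (D + p z <_) (sym (trans (pos-inner c) n≡D+D)) (+-monoʳ-< D (O.p<D c)))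

    pos<n : ∀ z → pos z < n
    pos<n z with Co? z in eq
    ... | yes c = ∸-monoʳ-< (O.p-pos c) (≤-trans (<⇒≤ (O.p<D c)) D≤n)
    ... | no z∉ = ≤-trans (s≤s (p≤D z∉)) (subst (suc D ≤_) (sym n≡D+D) (+-monoˡ-≤ D (≤-trans (s≤s z≤n) 2≤D)))

    pos-injective : ∀ {u v} → pos u ≡ pos v → u ≡ v
    pos-injective {u} {v} eq = by-side (Co? u) (Co? v)
      where
      outer : ¬ Co u → ¬ Co v → Place u → Place v → p u ≡ p v → u ≡ v
      outer u∉ v∉ (in-C cu) (in-C cv) e = full⇒layer-unique S full cu cv e
      outer u∉ v∉ (in-C cu) (at-a refl) e = contradiction (p-pos cu) (≤⇒≯ (≤-reflexive (trans e (d-refl a))))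
      outer u∉ v∉ (in-C cu) (at-b refl) e = contradiction (p<D cu) (≤⇒≯ (≤-reflexive (sym e)))
      outer u∉ v∉ (at-a refl) _ e = d-zero (trans (sym e) (d-refl a))
      outer u∉ v∉ (at-b refl) (in-C cv) e = contradiction (p<D cv) (≤⇒≯ (≤-reflexive e))
      outer u∉ v∉ (at-b refl) (at-a refl) e = sym (d-zero (trans e (d-refl a)))
      outer u∉ v∉ (at-b refl) (at-b refl) e = refl
      outer u∉ v∉ (in-Co cu) _ e = contradiction cu u∉
      outer u∉ v∉ _ (in-Co cv) e = contradiction cv v∉

      by-side : Dec (Co u) → Dec (Co v) → u ≡ v
      by-side (yes cu) (yes cv) = full⇒layer-unique (coSide S full) (count-Co-full S full) cu cv
          (+-cancelˡ-≡ (pos u) _ _ (trans (pos-inner cu) (trans (sym (pos-inner cv)) (cong (_+ p v) (sym eq)))))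
      by-side (yes cu) (no v∉) = contradiction (pos-inner->D cu) (≤⇒≯ (≤-trans (≤-reflexive (trans eq (pos-outer v∉))) (p≤D v∉)))
      by-side (no u∉) (yes cv) = contradiction (pos-inner->D cv) (≤⇒≯ (≤-trans (≤-reflexive (trans (sym eq) (pos-outer u∉))) (p≤D u∉)))
      by-side (no u∉) (no v∉) = outer u∉ v∉ (place u) (place v) (trans (sym (pos-outer u∉)) (trans eq (pos-outer v∉)))

    f : V → Fin n
    f z = fromℕ< (pos<n z)

    toℕ-f : ∀ z → toℕ (f z) ≡ pos z
    toℕ-f z = toℕ-fromℕ< (pos<n z)

    f-injective : ∀ {u v} → f u ≡ f v → u ≡ v
    f-injective {u} {v} eq = pos-injective (trans (sym (toℕ-f u)) (trans (cong toℕ eq) (toℕ-f v)))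

    succ : ∀ {u v} → suc (pos u) ≡ pos v → CycSucc n (f u) (f v)
    succ {u} {v} eq = inj₁ (trans (cong suc (toℕ-f u)) (trans eq (sym (toℕ-f v))))

    ¬Co-a : ¬ Co a
    ¬Co-a c = proj₁ (proj₂ c) refl

    ¬Co-b : ¬ Co b
    ¬Co-b c = proj₂ (proj₂ c) refl

    nbr∉Co : ∀ {u v} → C u → Adj u v → ¬ Co v
    nbr∉Co c e r with closed c e
    ... | inj₁ cv = proj₁ r cv
    ... | inj₂ (inj₁ eq) = proj₁ (proj₂ r) eq
    ... | inj₂ (inj₂ eq) = proj₂ (proj₂ r) eq

    C⇒CycAdj : ∀ {u v} → C u → Adj u v → CycAdj n (f u) (f v)
    C⇒CycAdj {u} {v} c e with edge c e
    ... | inj₁ (up , _) = inj₁ (succ (trans (cong suc (pos-outer λ r → proj₁ r c))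
                            (trans (sym up) (sym (pos-outer (nbr∉Co c e))))))
    ... | inj₂ (down , _) = inj₂ (succ (trans (cong suc (pos-outer (nbr∉Co c e)))
                              (trans (sym down) (sym (pos-outer λ r → proj₁ r c)))))

    Co⇒CycAdj : ∀ {u v} → Co u → Adj u v → CycAdj n (f u) (f v)
    Co⇒CycAdj {u} {v} c e with O.edge c e | O.closed c e
    ... | inj₁ (up , _) | inj₁ cv = inj₂ (succ (+-cancelʳ-≡ (p u) _ _ (begin
          suc (pos v + p u)  ≡⟨ +-suc (pos v) (p u) ⟨
          pos v + suc (p u)  ≡⟨ cong (pos v +_) up ⟨
          pos v + p v        ≡⟨ pos-inner cv ⟩
          n                  ≡⟨ pos-inner c ⟨
          pos u + p u        ∎)))
      where open ≡-Reasoning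
    ... | inj₁ (up , _) | inj₂ (inj₁ refl) = contradiction (trans (sym up) (d-refl a)) λ ()
    ... | inj₁ (up , _) | inj₂ (inj₂ refl) = inj₂ (succ (+-cancelʳ-≡ (p u) _ _ (begin
          suc (pos b + p u)  ≡⟨ +-suc (pos b) (p u) ⟨
          pos b + suc (p u)  ≡⟨ cong₂ _+_ (pos-outer ¬Co-b) (sym up) ⟩
          D + D              ≡⟨ n≡D+D ⟨
          n                  ≡⟨ pos-inner c ⟨
          pos u + p u        ∎)))
      where open ≡-Reasoning
    ... | inj₂ (down , _) | inj₁ cv = inj₁ (succ (+-cancelʳ-≡ (p v) _ _ (begin
          suc (pos u + p v)  ≡⟨ +-suc (pos u) (p v) ⟨
          pos u + suc (p v)  ≡⟨ cong (pos u +_) down ⟨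
          pos u + p u        ≡⟨ pos-inner c ⟩
          n                  ≡⟨ pos-inner cv ⟨
          pos v + p v        ∎)))
      where open ≡-Reasoning
    ... | inj₂ (down , _) | inj₂ (inj₁ refl) = inj₁ (inj₂
          ( trans (cong suc (toℕ-f u)) (trans (+-comm 1 (pos u)) (trans (cong (pos u +_) (sym (trans down (cong suc (d-refl a))))) (pos-inner c)))
          , trans (toℕ-f a) (trans (pos-outer ¬Co-a) (d-refl a))))
    ... | inj₂ (down , _) | inj₂ (inj₂ refl) = contradiction (O.p<D c) (≤⇒≯ (≤-trans (n≤1+n D) (≤-reflexive (sym down))))

    adj⇒CycAdj : ∀ {u v} → Adj u v → CycAdj n (f u) (f v)
    adj⇒CycAdj {u} {v} e = go (place u) (place v)
      where
      go : Place u → Place v → CycAdj n (f u) (f v)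
      go (in-C c) _ = C⇒CycAdj c e
      go (in-Co c) _ = Co⇒CycAdj c e
      go _ (in-C c) = CycAdj-sym (C⇒CycAdj c (adj-swap e))
      go _ (in-Co c) = CycAdj-sym (Co⇒CycAdj c (adj-swap e))
      go (at-a refl) (at-a refl) = contradiction refl (adj⇒≢ e)
      go (at-a refl) (at-b refl) = contradiction e ¬adj-ab
      go (at-b refl) (at-a refl) = contradiction (adj-swap e) ¬adj-ab
      go (at-b refl) (at-b refl) = contradiction refl (adj⇒≢ e)

    Two : V → Set
    Two u = ∃ λ v → ∃ λ w → Adj u v × Adj u w × v ≢ w

    two-inside : ∀ {a b C} {C? : Decidable C} (S : Side a b C?) → ∀ {u} → C u → Two u
    two-inside {a} {b} S {u} c with d a u in pu | d b u in qu | SideProps.p-pos S c | SideProps.q-pos S c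
    ... | zero | _ | pp | _ = contradiction pp λ ()
    ... | suc _ | zero | _ | qq = contradiction qq λ ()
    ... | suc j | suc k | _ | _ with v , e , pv ← d-pred a u pu | w , e′ , qw ← d-pred b u qu =
      -- A common first vertex on the way to both gates would lower both distances at once.
      v , w , e , e′ , λ { refl → SideProps.no-double-drop S c e (trans pu (cong suc (sym pv))) (trans qu (cong suc (sym qw))) }

    two : ∀ u → Two u
    two u with place u
    ... | in-C c = two-inside S c
    ... | in-Co c = two-inside (coSide S full) c
    ... | at-a refl = proj₁ near , proj₁ O.near , d≡1⇒adj (proj₂ (proj₂ near)) , d≡1⇒adj (proj₂ (proj₂ O.near)) ,
          λ eq → proj₁ (proj₁ (proj₂ O.near)) (subst C eq (proj₁ (proj₂ near)))
    ... | at-b refl = proj₁ Op.near , proj₁ O.Op.near , d≡1⇒adj (proj₂ (proj₂ Op.near)) , d≡1⇒adj (proj₂ (proj₂ O.Op.near)) ,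
          λ eq → proj₁ (proj₁ (proj₂ O.Op.near)) (subst C eq (proj₁ (proj₂ Op.near)))

    -- At most two positions are adjacent to that of `u`, and two distinct neighbours of `u` already
    -- occupy them.
    CycAdj⇒adj : ∀ {u w} → CycAdj n (f u) (f w) → Adj u w
    CycAdj⇒adj {u} {w} h with v₁ , v₂ , e₁ , e₂ , neq ← two u
      with CycAdj-pigeonhole (adj⇒CycAdj e₁) (adj⇒CycAdj e₂) h
    ... | inj₁ eq = contradiction (f-injective eq) neq
    ... | inj₂ (inj₁ eq) = subst (Adj u) (f-injective eq) e₁
    ... | inj₂ (inj₂ eq) = subst (Adj u) (f-injective eq) e₂

    isCycle : IsCycle G
    isCycle = subst (3 ≤_) (sym n≡D+D) (≤-trans (s≤s (s≤s (s≤s z≤n))) (+-mono-≤ 2≤D 2≤D))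
      , injective⇒↔ f f-injective , λ u v → mk⇔ adj⇒CycAdj CycAdj⇒adj

  -- Levels of p - q outside a side.

  -- The vertices outside C are compared with the level p − q = l − k, written without
  -- subtraction; X and Y are its two sides, and gap says that p − q has the parity of D.
  module Levels {a b : V} {C : Pred V 0ℓ} {C? : Decidable C} (S : Side a b C?) (k l : ℕ)
    (parity : par k ≡ par (l + d a b)) where
    open TwoSided S

    X : V → Set
    X z = ¬ C z × p z + k < q z + l

    X? : Decidable X
    X? z = ¬? (C? z) ×-dec (p z + k <? q z + l)

    Level : V → Set
    Level z = ¬ C z × p z + k ≡ q z + l

    Level? : Decidable Level
    Level? z = ¬? (C? z) ×-dec (p z + k ≟ℕ q z + l)

    Y : V → Set
    Y z = ¬ C z × q z + l < p z + k

    Y? : Decidable Y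
    Y? z = ¬? (C? z) ×-dec (q z + l <? p z + k)

    opaque
      gap : ∀ z → suc (p z + k) ≢ q z + l
      gap z eq = xor-parity-mismatch (col a) (col b) (col z) (par l) (begin
        not ((col a xor col z) xor (par l xor (col a xor col b)))
          ≡⟨ cong not (cong₂ _xor_ (par-d a z) (trans (par-+ l D) (cong (par l xor_) (par-d a b)))) ⟨
        not (par (p z) xor par (l + D))  ≡⟨ cong (λ x → not (par (p z) xor x)) parity ⟨
        not (par (p z) xor par k)        ≡⟨ cong not (par-+ (p z) k) ⟨
        par (suc (p z + k))              ≡⟨ cong par eq ⟩
        par (q z + l)                    ≡⟨ par-+ (q z) l ⟩
        par (q z) xor par l              ≡⟨ cong (_xor par l) (par-d b z) ⟩
        (col b xor col z) xor par l      ∎)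
        where open ≡-Reasoning

    trichotomy : ∀ {z} → ¬ C z → X z ⊎ Level z ⊎ Y z
    trichotomy {z} z∉ with <-cmp (p z + k) (q z + l)
    ... | tri< lt _ _ = inj₁ (z∉ , lt)
    ... | tri≈ _ eq _ = inj₂ (inj₁ (z∉ , eq))
    ... | tri> _ _ gt = inj₂ (inj₂ (z∉ , gt))

    -- If `w` were beyond the level, the Lipschitz bounds would squeeze `z` to exactly one below it,
    -- which parity excludes through `gap`.
    X-step : ∀ {z w} → X z → Adj z w → C w ⊎ X w ⊎ Level w
    X-step {z} {w} (_ , lt) e with C? w
    ... | yes c = inj₁ c
    ... | no w∉ with trichotomy w∉
    ...   | inj₁ x = inj₂ (inj₁ x)
    ...   | inj₂ (inj₁ x) = inj₂ (inj₂ x)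
    ...   | inj₂ (inj₂ (_ , gt)) = ⊥-elim (gap z (≤-antisym lt (begin
        q z + l        ≤⟨ +-monoˡ-≤ l (d-lip b e) ⟩
        suc (q w + l)  ≤⟨ gt ⟩
        p w + k        ≤⟨ +-monoˡ-≤ k (d-lip a (adj-swap e)) ⟩
        suc (p z + k)  ∎)))
      where open ≤-Reasoning

    opaque
      count-levels : count C? + (count X? + (count Level? + count Y?)) ≡ m + m
      count-levels = trans (cong (count C? +_) (sym (trans
          (count-≡-∪ ∁? X? rest? (λ z → split z) (λ _ → proj₁)
             (λ { _ (inj₁ x) → proj₁ x ; _ (inj₂ x) → proj₁ x })
             (λ { _ (_ , lt) (inj₁ (_ , eq)) → <-irrefl eq lt ; _ (_ , lt) (inj₂ (_ , gt)) → <-asym lt gt }))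
          (cong (count X? +_) (count-≡-∪ rest? Level? Y? (λ _ → id) (λ _ → inj₁) (λ _ → inj₂)
             λ { _ (_ , eq) (_ , gt) → <-irrefl (sym eq) gt })))))
        (count-∁ C?)
        where
        ∁? : Decidable (λ z → ¬ C z)
        ∁? z = ¬? (C? z)

        rest? : Decidable (λ z → Level z ⊎ Y z)
        rest? z = Level? z ⊎-dec Y? z

        split : ∀ z → ¬ C z → X z ⊎ (Level z ⊎ Y z)
        split z z∉ = trichotomy z∉

    Low : V → Set
    Low z = X z × z ≢ a

    Low? : Decidable Low
    Low? = X? ∖? a

    module _ (l<D+k : l < D + k) where

      X⇒≢b : ∀ {z} → X z → z ≢ b
      X⇒≢b (_ , lt) refl = <-asym l<D+k (subst (λ x → D + k < x + l) (d-refl b) lt)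

      -- Only `a` and `b` see `C` from outside, and neither is in `Low`; the way up is blocked by
      -- the level, that is, by `t`.
      lowSide : ∀ {t} → (∀ z → Level z → z ≡ t) → ¬ Low t → ∃ Low → count Low? < m → Side a t Low?
      lowSide {t} uniq t∉ ne sm = record
        { a∉ = λ x → proj₂ x refl ; b∉ = t∉ ; nonempty = ne ; small = sm ; closed = closed′ }
        where
        closed′ : ∀ {z w} → Low z → Adj z w → Low w ⊎ w ≡ a ⊎ w ≡ t
        closed′ {z} {w} (x , z≢a) e with X-step x e
        ... | inj₂ (inj₂ lev) = inj₂ (inj₂ (uniq w lev))
        ... | inj₁ cw with closed cw (adj-swap e)
        ...   | inj₁ cz = contradiction cz (proj₁ x)
        ...   | inj₂ (inj₁ eq) = contradiction eq z≢a
        ...   | inj₂ (inj₂ eq) = contradiction eq (X⇒≢b x)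
        closed′ {z} {w} (x , z≢a) e | inj₂ (inj₁ xw) with w ≟ a
        ... | yes eq = inj₂ (inj₁ eq)
        ... | no neq = inj₁ (xw , neq)

    module _ (k<D+l : k < D + l) where

      Op-Far⇒X : ∀ {z} → Op.Far z → X z
      Op-Far⇒X {z} (z∉ , eq) = z∉ , subst (p z + k <_)
        (trans (sym (+-assoc (p z) D l)) (cong (_+ l) (sym (trans eq (cong (p z +_) (d-sym b a))))))
        (+-monoʳ-< (p z) k<D+l)

      a∈X : X a
      a∈X = Op-Far⇒X Op.Far-b

      Level⇒¬Op-Far : ∀ {z} → Level z → ¬ Op.Far z
      Level⇒¬Op-Far lev f = <-irrefl (proj₂ lev) (proj₂ (Op-Far⇒X f))

  opaque
    -- With |C| ≤ m - 2, `count-near` leaves room for a far vertex besides `b`. Applied to the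
    -- exchanged gates, it makes `Low` nonempty.
    far-≥2 : ∀ {a b C} {C? : Decidable C} (S : Side a b C?) → suc (suc (count C?)) ≤ m →
      ∃ λ z → SideProps.Far S z × z ≢ b
    far-≥2 {a} {b} {C} {C?} S c+2≤m = count-witness (Far? ∖? b)
        (arith m (count C?) (count Far?) (count Near?) (count-pos Near? (proj₂ near)) c+2≤m count-near (count-∖ Far? Far-b))
      where
      open SideProps S
      arith : ∀ m c f l {f′} → 1 ≤ l → suc (suc c) ≤ m → m + l ≤ c + f + 1 → f ≡ suc f′ → 1 ≤ f′
      arith m c f l {f′} h₁ h₂ h₃ refl = ≤-by 0 (+-mono-≤ (+-mono-≤ h₁ h₂) h₃) (eq m c l f′)
        where
        eq : ∀ m c l f′ → ((1 + suc (suc c)) + (m + l)) + f′ ≡ (l + m + (c + suc f′ + 1)) + 1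
        eq = solve-∀

  module _ (¬cycle : ¬ IsCycle G) where

    no-full : ∀ {a b C} {C? : Decidable C} → Side a b C? → suc (count C?) ≢ m
    no-full S full = ¬cycle (FullCycle.isCycle S full)

    slack : ∀ {a b C} {C? : Decidable C} → Side a b C? → suc (suc (count C?)) ≤ m
    slack S = ≤∧≢⇒< (Side.small S) (no-full S)

    module _ {a b : V} {C : Pred V 0ℓ} {C? : Decidable C} (S : Side a b C?) where
      open TwoSided S

      module _ (k l : ℕ) (parity : par k ≡ par (l + D)) (k<D+l : k < D + l) where
        open Levels S k l parity

        low-nonempty : ∃ Low
        low-nonempty with z , far , neq ← far-≥2 (swap S) (slack S) = z , Op-Far⇒X k<D+l far , neq

    par-swap : ∀ {a b} k l → par k ≡ par (l + d a b) → par l ≡ par (k + d b a)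
    par-swap {a} {b} k l eq rewrite par-+ l (d a b) | par-+ k (d b a) | d-sym b a | eq with par l | par (d a b)
    ... | true  | true  = refl
    ... | true  | false = refl
    ... | false | true  = refl
    ... | false | false = refl

    module Split {a b : V} {C : Pred V 0ℓ} {C? : Decidable C} (S : Side a b C?)
      (k l : ℕ) (parity : par k ≡ par (l + d a b)) (k<D+l : k < d a b + l) (l<D+k : l < d a b + k) where
      open TwoSided S
      open Levels S k l parity public
      -- The same level seen from `b`, so `H.Low` is the part beyond it without `b`.
      module H = Levels (swap S) l k (par-swap {a} {b} k l parity)

      private
        l<D+k′ : l < d b a + k
        l<D+k′ = subst (λ x → l < x + k) (d-sym a b) l<D+k
        k<D+l′ : k < d b a + l
        k<D+l′ = subst (λ x → k < x + l) (d-sym a b) k<D+l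

      count-split : count C? + (suc (count Low?) + (count Level? + suc (count H.Low?))) ≡ m + m
      count-split = trans (cong₂ (λ x y → count C? + (x + (count Level? + y)))
        (sym (count-∖ X? (a∈X k<D+l))) (sym (count-∖ H.X? (H.a∈X l<D+k′)))) count-levels

      lowSide′ : ∀ {t} → (∀ z → Level z → z ≡ t) → ¬ Low t → count Low? < m → Side a t Low?
      lowSide′ u t∉ = lowSide l<D+k u t∉ (low-nonempty S k l parity k<D+l)

      highSide′ : ∀ {t} → (∀ z → Level z → z ≡ t) → ¬ H.Low t → count H.Low? < m → Side b t H.Low?
      highSide′ u t∉ = H.lowSide k<D+l′ (λ z r → u z (proj₁ r , sym (proj₂ r))) t∉
        (low-nonempty (swap S) l k (par-swap {a} {b} k l parity) l<D+k′)

      Level⇒Mid : ∀ z → Level z → Mid z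
      Level⇒Mid z lev = proj₁ lev , H.Level⇒¬Op-Far l<D+k′ (proj₁ lev , sym (proj₂ lev)) , Level⇒¬Op-Far k<D+l lev

      opaque
        -- With an empty level, `a` alone would cut off `Low` and `b` alone would cut off `H.Low`.
        -- The two have fewer than 2m vertices together, so one of them is small enough to be a side
        -- with equal gates.
        level-nonempty : 1 ≤ count Level?
        level-nonempty with count Level? in eq
        ... | suc _ = s≤s z≤n
        ... | zero = ⊥-elim (case (count Low? <? m) of λ
            { (yes lo) → no-cut-vertex (lowSide′ none (λ r → proj₂ r refl) lo)
            ; (no ≥lo) → case (count H.Low? <? m) of λ
              { (yes hi) → no-cut-vertex (highSide′ none (λ r → proj₂ r refl) hi)
              ; (no ≥hi) → arith m (count C?) (count Low?) (count Level?) (count H.Low?) (≮⇒≥ ≥lo) (≮⇒≥ ≥hi) count-split } })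
          where
          none : ∀ {t} z → Level z → z ≡ t
          none z lev = contradiction (count-pos Level? lev) (≤⇒≯ (≤-reflexive eq))

          arith : ∀ m c lo le hi → m ≤ lo → m ≤ hi → c + (suc lo + (le + suc hi)) ≡ m + m → ⊥
          arith m c lo le hi h₁ h₂ h₃ = ⊥-by (suc (c + le)) (+-mono-≤ (+-mono-≤ h₁ h₂) (≤-reflexive h₃)) (e m c lo le hi)
            where
            e : ∀ m c lo le hi → (m + m) + (c + (suc lo + (le + suc hi))) ≡ suc (suc (c + le) + (lo + hi + (m + m)))
            e = solve-∀

      module _ (single : count Level? ≡ 1) where

        t : V
        t = proj₁ (count-witness Level? (≤-reflexive (sym single)))

        t-level : Level t
        t-level = proj₂ (count-witness Level? (≤-reflexive (sym single)))

        level≡t : ∀ z → Level z → z ≡ t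
        level≡t z lev = count-unique Level? (≤-reflexive single) lev t-level

        low : count Low? < m → Side a t Low?
        low = lowSide′ level≡t (λ r → <-irrefl (proj₂ t-level) (proj₂ (proj₁ r)))

        high : count H.Low? < m → Side b t H.Low?
        high = highSide′ level≡t (λ r → <-irrefl (sym (proj₂ t-level)) (proj₂ (proj₁ r)))

  -- From a failure of 3-connectedness to a side.

  record SomeSide : Set₁ where
    field
      {a b} : V
      {C}   : Pred V 0ℓ
      {C?}  : Decidable C
      side  : Side a b C?

  module _ (a b : V) {u v : V} (ou : Ok G a b u) (ov : Ok G a b v)
    (sep : reach (delete G a b) n u v ≡ false) where

    private
      H : Graph n
      H = delete G a b

      R Q : V → Set
      R z = Reach H n u z × Ok G a b z
      Q z = ¬ Reach H n u z × Ok G a b z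

      R? : Decidable R
      R? z = (reach H n u z ≟ᵇ true) ×-dec ok? G a b z

      Q? : Decidable Q
      Q? z = ¬? (reach H n u z ≟ᵇ true) ×-dec ok? G a b z

      extend : ∀ {z w} → Reach H n u z → Ok G a b z → Adj z w → Ok G a b w → Reach H n u w
      extend {z} {w} r oz e ow = reach⇒reach-n H {n + 1}
        (reach-trans H n {1} r (reach-adj H (delete-adj⁺ G a b e oz ow)))

      place : ∀ w → Ok G a b w ⊎ w ≡ a ⊎ w ≡ b
      place w with w ≟ a | w ≟ b
      ... | yes eq | _      = inj₂ (inj₁ eq)
      ... | no _   | yes eq = inj₂ (inj₂ eq)
      ... | no x   | no y   = inj₁ (x , y)

      R-side : count R? < m → Side a b R?
      R-side sm = record
        { a∉ = λ r → proj₁ (proj₂ r) refl ; b∉ = λ r → proj₂ (proj₂ r) refl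
        ; nonempty = u , reach-mono H {0} {n} {u} z≤n (reach-refl H) , ou ; small = sm
        ; closed = λ {z} {w} r e → map₁ (λ ow → extend (proj₁ r) (proj₂ r) e ow , ow) (place w) }

      Q-side : count Q? < m → Side a b Q?
      Q-side sm = record
        { a∉ = λ r → proj₁ (proj₂ r) refl ; b∉ = λ r → proj₂ (proj₂ r) refl
        ; nonempty = v , (λ r → contradiction (trans (sym sep) r) λ ()) , ov ; small = sm
        ; closed = λ {z} {w} r e → map₁ (λ ow → (λ rw → proj₁ r (extend rw ow (adj-swap e) (proj₂ r))) , ow) (place w) }

      R∪Q? : Decidable (λ z → R z ⊎ Q z)
      R∪Q? z = R? z ⊎-dec Q? z

      -- The deleted vertices may coincide, so only one of them is counted.
      total : 1 + (count R? + count Q?) ≤ m + m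
      total = begin
        1 + (count R? + count Q?)       ≤⟨ s≤s (count-∪-≤ R∪Q? R? Q? (λ _ → inj₁) (λ _ → inj₂) (λ _ x y → proj₁ y (proj₁ x))) ⟩
        1 + count R∪Q?                  ≡⟨ cong (_+ count R∪Q?) (count-singleton a) ⟨
        count (_≟ a) + count R∪Q?       ≤⟨ +-monoʳ-≤ (count (_≟ a)) (count-mono R∪Q? (λ z → ¬? (z ≟ a))
                                             (λ { _ (inj₁ x) → proj₁ (proj₂ x) ; _ (inj₂ x) → proj₁ (proj₂ x) })) ⟩
        count (_≟ a) + count (λ z → ¬? (z ≟ a))  ≡⟨ count-∁ (_≟ a) ⟩
        m + m                           ∎
        where open ≤-Reasoning

    -- `R` is the component of `u` and `Q` the remainder. Together they miss `a`, so one of them has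
    -- fewer than m vertices.
    separated⇒side : SomeSide
    separated⇒side = choose (count R? <? m) (count Q? <? m)
      where
      choose : Dec (count R? < m) → Dec (count Q? < m) → SomeSide
      choose (yes lt) _ = record { side = R-side lt }
      choose (no _) (yes lt) = record { side = Q-side lt }
      choose (no x) (no y) = ⊥-elim (1+n≰n (≤-trans (s≤s (+-mono-≤ (≮⇒≥ x) (≮⇒≥ y))) total))

  -- The hypothesis is a bare negation, so the cut is found by a decidable search over all
  -- quadruples; if the search fails, G is 3-connected.
  ¬3-connected⇒side : 4 ≤ n → ¬ ThreeConnected G → SomeSide
  ¬3-connected⇒side 4≤n ¬3c = choose (any? λ a → any? λ b → any? λ u → any? λ v → bad? a b u v)
    where
    Bad : V → V → V → V → Set
    Bad a b u v = Ok G a b u × Ok G a b v × reach (delete G a b) n u v ≡ false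

    bad? : ∀ a b u v → Dec (Bad a b u v)
    bad? a b u v = ok? G a b u ×-dec ok? G a b v ×-dec (reach (delete G a b) n u v ≟ᵇ false)

    joined : ∀ a b u v → ¬ Bad a b u v → u ≢ a → u ≢ b → v ≢ a → v ≢ b → WalkIn G (Ok G a b) u v
    joined a b u v ¬bad ua ub va vb with reach (delete G a b) n u v in eq
    ... | true = delete-walk G a b n (ua , ub) eq
    ... | false = contradiction ((ua , ub) , (va , vb) , refl) ¬bad

    choose : Dec (∃ λ a → ∃ λ b → ∃ λ u → ∃ λ v → Bad a b u v) → SomeSide
    choose (yes (a , b , u , v , ou , ov , sep)) = separated⇒side a b ou ov sep
    choose (no none) = contradiction (4≤n , conn , λ a b u v → joined a b u v (λ bad → none (a , b , u , v , bad))) ¬3c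

  -- Degrees and gate distances when the graph is not a cycle.

  module NonCycle (¬cycle : ¬ IsCycle G) (2≤m : 2 ≤ m) where

    module _ {x u v : V} (S : Side u v (_≟ x)) where
      open TwoSided S

      private
        D≡2 : D ≡ 2
        D≡2 = trans (sym (layered refl)) (cong₂ _+_
          (trans (cong p (sym (proj₁ (proj₂ near)))) (proj₂ (proj₂ near)))
          (trans (cong q (sym (proj₁ (proj₂ Op.near)))) (proj₂ (proj₂ Op.near))))

        parity : par 0 ≡ par (0 + D)
        parity = cong par (sym D≡2)

        0<D : 0 < D + 0
        0<D = subst (λ x → 0 < x + 0) (sym D≡2) (s≤s z≤n)

      module Balance = Levels S 0 0 parity
      open Balance

      -- `count-near` at the gate `v` of the side {x}: its far vertices are reached from `x` through
      -- `u`, hence are closer to `u` than to `v`.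
      count-X-≥ : m ≤ suc (count X?)
      count-X-≥ = arith m (count Op.Near?) (count-pos Op.Near? (proj₂ Op.near))
        (subst (λ c → m + count Op.Near? ≤ c + count Op.Far? + 1) (count-singleton x) Op.count-near)
        (count-mono Op.Far? X? (λ _ → Op-Far⇒X 0<D))
        where
        arith : ∀ m l {f y} → 1 ≤ l → m + l ≤ 1 + f + 1 → f ≤ y → m ≤ suc y
        arith m l {f} {y} h₁ h₂ h₃ = ≤-by 0 (+-mono-≤ (+-mono-≤ h₁ h₂) h₃) (e m l f y)
          where
          e : ∀ m l f y → (1 + (m + l) + f) + suc y ≡ (l + (1 + f + 1) + y) + m
          e = solve-∀

      -- Under these sizes `X` is a side with m - 1 vertices, cut off by `x` and the vertex of the
      -- level, or by `x` alone if the level is empty.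
      thin⇒⊥ : count Level? ≤ 1 → suc (count X?) ≢ m
      thin⇒⊥ thin full with any? Level?
      ... | yes (t , lev) = no-full ¬cycle (side (λ w lw → count-unique Level? thin lw lev)
                              λ r → <-irrefl (proj₂ lev) (proj₂ r)) full
        where
        side : ∀ {t} → (∀ w → Level w → w ≡ t) → ¬ X t → Side x t X?
        side uniq t∉ = record
          { a∉ = λ r → proj₁ r refl ; b∉ = t∉ ; nonempty = u , a∈X 0<D ; small = ≤-reflexive full
          ; closed = λ {z} {w} r e → case X-step r e of λ
              { (inj₁ eq) → inj₂ (inj₁ eq) ; (inj₂ (inj₁ r′)) → inj₁ r′ ; (inj₂ (inj₂ lw)) → inj₂ (inj₂ (uniq w lw)) } }
      ... | no none = no-full ¬cycle cut full
        where
        cut : Side x x X?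
        cut = record
          { a∉ = λ r → proj₁ r refl ; b∉ = λ r → proj₁ r refl ; nonempty = u , a∈X 0<D ; small = ≤-reflexive full
          ; closed = λ {z} {w} r e → case X-step r e of λ
              { (inj₁ eq) → inj₂ (inj₁ eq) ; (inj₂ (inj₁ r′)) → inj₁ r′ ; (inj₂ (inj₂ lw)) → contradiction (w , lw) none } }

    opaque
      -- The vertices other than `x` number 2m - 1 and split into those closer to `u`, those closer
      -- to `v` and the balanced ones. The first two sets have at least m - 1 vertices each, so at
      -- most one vertex is balanced and one of the two sets has exactly m - 1. The choice `u` = `v`
      -- covers degree one.
      degree-≥3 : ∀ {x u v} → u ≢ x → v ≢ x → (∀ w → Adj x w → w ≡ u ⊎ w ≡ v) → ⊥
      degree-≥3 {x} {u} {v} u≢x v≢x nbrs = finish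
        where
        S : Side u v (_≟ x)
        S = record
          { a∉ = u≢x ; b∉ = v≢x ; closed = λ { refl e → inj₂ (nbrs _ e) } ; nonempty = x , refl
          ; small = subst (_< m) (sym (count-singleton x)) 2≤m }

        module L = Balance S
        module R = Balance (swap S)

        X≥ : m ≤ suc (count L.X?)
        X≥ = count-X-≥ S

        Y≥ : m ≤ suc (count L.Y?)
        Y≥ = count-X-≥ (swap S)

        total : 1 + (count L.X? + (count L.Level? + count L.Y?)) ≡ m + m
        total = trans (cong (_+ (count L.X? + (count L.Level? + count L.Y?))) (sym (count-singleton x))) L.count-levels

        thin : count L.Level? ≤ 1
        thin = arith m (count L.X?) (count L.Level?) (count L.Y?) X≥ Y≥ total
          where
          arith : ∀ m x l y → m ≤ suc x → m ≤ suc y → 1 + (x + (l + y)) ≡ m + m → l ≤ 1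
          arith m x l y h₁ h₂ h₃ = ≤-by 0 (+-mono-≤ (+-mono-≤ h₁ h₂) (≤-reflexive h₃)) (e m x l y)
            where
            e : ∀ m x l y → ((m + m) + (1 + (x + (l + y)))) + 1 ≡ (suc x + suc y + (m + m)) + l
            e = solve-∀

        thin′ : count R.Level? ≤ 1
        thin′ = ≤-trans (count-mono R.Level? L.Level? (λ _ r → proj₁ r , sym (proj₂ r))) thin

        finish : ⊥
        finish with m ≟ℕ suc (count L.X?)
        ... | yes eq = thin⇒⊥ S thin (sym eq)
        ... | no neq = thin⇒⊥ (swap S) thin′ (≤-antisym
            (arith m (count L.X?) (count L.Level?) (count L.Y?) (≤∧≢⇒< X≥ neq) total) Y≥)
          where
          arith : ∀ m x l y → suc m ≤ suc x → 1 + (x + (l + y)) ≡ m + m → suc y ≤ m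
          arith m x l y h₁ h₂ = ≤-by l (+-mono-≤ h₁ (≤-reflexive h₂)) (e m x l y)
            where
            e : ∀ m x l y → (suc m + (1 + (x + (l + y)))) + m ≡ l + ((suc x + (m + m)) + suc y)
            e = solve-∀

    -- If D = 2, then `C` is a single layer; layers carry no edges, so its vertices have no
    -- neighbours but `a` and `b`.
    3≤D : ∀ {a b C} {C? : Decidable C} → Side a b C? → 3 ≤ d a b
    3≤D {a} {b} {C} S = ≤∧≢⇒< 2≤D λ 2≡D → degree-≥3 (λ { refl → a∉ c }) (λ { refl → b∉ c }) (nbrs 2≡D)
      where
      open SideProps S
      r = proj₁ nonempty
      c = proj₂ nonempty

      p≡1 : 2 ≡ D → ∀ {z} → C z → p z ≡ 1
      p≡1 2≡D {z} cz = ≤-antisym (≤-pred (subst (p z <_) (sym 2≡D) (p<D cz))) (p-pos cz)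

      nbrs : 2 ≡ D → ∀ w → Adj r w → w ≡ a ⊎ w ≡ b
      nbrs 2≡D w e with closed c e
      ... | inj₂ x = x
      ... | inj₁ cw = contradiction (trans (p≡1 2≡D c) (sym (p≡1 2≡D cw))) (adj-d-≢ a e)

    -- Sides of minimal size.

    Minimal : ℕ → Set₁
    Minimal c = ∀ {a b} {C : Pred V 0ℓ} {C? : Decidable C} → Side a b C? → c ≤ count C?

    side-cong : ∀ {a b} {P Q : Pred V 0ℓ} (P? : Decidable P) (Q? : Decidable Q) →
      (∀ z → P z → Q z) → (∀ z → Q z → P z) → Side a b P? → Side a b Q?
    side-cong P? Q? f g S = record
      { a∉ = a∉ ∘ g _ ; b∉ = b∉ ∘ g _ ; nonempty = proj₁ nonempty , f _ (proj₂ nonempty)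
      ; small = ≤-trans (s≤s (count-mono Q? P? g)) small
      ; closed = λ c e → case closed (g _ c) e of λ { (inj₁ x) → inj₁ (f _ x) ; (inj₂ x) → inj₂ x } }
      where open Side S

    side? : ∀ a b {C : Pred V 0ℓ} (C? : Decidable C) → Dec (Side a b C?)
    side? a b {C} C? = map′ build
      (λ S → Side.a∉ S , Side.b∉ S , (λ _ _ → Side.closed S) , Side.nonempty S , Side.small S)
      (¬? (C? a) ×-dec ¬? (C? b) ×-dec
       all? (λ r → all? (λ w → C? r →-dec (adj G r w ≟ᵇ true) →-dec (C? w ⊎-dec (w ≟ a) ⊎-dec (w ≟ b)))) ×-dec
       any? C? ×-dec (count C? <? m))
      where
      build : ¬ C a × ¬ C b × (∀ r w → C r → Adj r w → C w ⊎ w ≡ a ⊎ w ≡ b) × ∃ C × count C? < m → Side a b C?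
      build (x , y , z , u , v) = record { a∉ = x ; b∉ = y ; closed = λ {r} {w} → z r w ; nonempty = u ; small = v }

    record MinSide : Set₁ where
      field
        {a b}   : V
        {C}     : Pred V 0ℓ
        {C?}    : Decidable C
        side    : Side a b C?
        minimal : Minimal (count C?)

    -- Sides range over arbitrary decidable predicates; replacing these by characteristic vectors
    -- makes the existence of a smaller side decidable, and the descent on the size stops.
    minSide : ∀ {a b C} {C? : Decidable C} → Side a b C? → MinSide
    minSide {C? = C?} S = go (count C?) S ≤-refl
      where
      mem? : (s : Subset n) → Decidable (λ z → lookup s z ≡ true)
      mem? s z = lookup s z ≟ᵇ true

      Smaller : ℕ → Set
      Smaller c = ∃ λ s → ∃ λ a → ∃ λ b → Side a b (mem? s) × count (mem? s) < c

      smaller? : ∀ c → Dec (Smaller c)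
      smaller? c = anySubset? λ s → any? λ a → any? λ b → side? a b (mem? s) ×-dec (count (mem? s) <? c)

      no-smaller⇒minimal : ∀ c → ¬ Smaller c → Minimal c
      no-smaller⇒minimal c none {a} {b} {C} {C?} S = ≮⇒≥ λ lt →
        none (s , a , b , side-cong C? (mem? s) to from S , ≤-trans (s≤s (count-mono (mem? s) C? from)) lt)
        where
        s : Subset n
        s = tabulate (λ z → does (C? z))

        to : ∀ z → C z → lookup s z ≡ true
        to z c = trans (lookup∘tabulate _ z) (dec-true (C? z) c)

        from : ∀ z → lookup s z ≡ true → C z
        from z eq with C? z | trans (sym (lookup∘tabulate (λ z → does (C? z)) z)) eq
        ... | yes c | _ = c

      go : ∀ k {a b C} {C? : Decidable C} → Side a b C? → count C? ≤ k → MinSide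
      go k {C? = C?} S le with smaller? (count C?)
      ... | no none = record { side = S ; minimal = no-smaller⇒minimal (count C?) none }
      go zero S le | yes (_ , _ , _ , _ , lt) = contradiction (≤-trans lt le) λ ()
      go (suc k) S le | yes (_ , _ , _ , S′ , lt) = go k S′ (≤-pred (≤-trans lt le))

    module _ {a b : V} {C : Pred V 0ℓ} {C? : Decidable C} (S : Side a b C?) where
      open TwoSided S

      At? : ∀ i → Decidable (λ z → C z × p z ≡ i)
      At? i z = C? z ×-dec (p z ≟ℕ i)

      Above? : ∀ i → Decidable (λ z → C z × i < p z)
      Above? i z = C? z ×-dec (i <? p z)

      opaque
        aboveSide : ∀ i → 1 ≤ i → suc i < D → ∀ {c} → C c → p c ≡ i → (∀ z → C z → p z ≡ i → z ≡ c) →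
          Side c b (Above? i)
        aboveSide i 1≤i i<D {c} cc pc uniq = record
          { a∉ = λ r → <-irrefl (sym pc) (proj₂ r) ; b∉ = b∉ ∘ proj₁
          ; nonempty = above ; small = ≤-trans (s≤s (count-mono (Above? i) C? (λ _ → proj₁))) small
          ; closed = closed′ }
          where
          above : ∃ λ z → C z × i < p z
          above with z , cz , pz ← layer (suc i) (s≤s z≤n) i<D = z , cz , ≤-reflexive (sym pz)

          closed′ : ∀ {z w} → C z × i < p z → Adj z w → (C w × i < p w) ⊎ w ≡ c ⊎ w ≡ b
          closed′ {z} {w} (cz , lt) e with closed cz e
          ... | inj₂ (inj₂ eq) = inj₂ (inj₂ eq)
          ... | inj₂ (inj₁ refl) = contradiction (≤-trans lt (≤-trans (d-lip a e) (s≤s (≤-reflexive (d-refl a))))) (≤⇒≯ 1≤i)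
          ... | inj₁ cw with m≤n⇒m<n∨m≡n (≤-pred (≤-trans lt (d-lip a e)))
          ...   | inj₁ lt′ = inj₁ (cw , lt′)
          ...   | inj₂ eq = inj₂ (inj₁ (uniq w cw (sym eq)))

      opaque
        -- A layer with one vertex would, together with `b`, cut off the layers after it, a smaller
        -- side. Such layers exist only if `suc i < D`; the last layer is treated as the first one
        -- seen from `b`.
        layers-thick : Minimal (count C?) → ∀ i → 1 ≤ i → suc i < D → 2 ≤ count (At? i)
        layers-thick min i 1≤i i<D with z , cz , pz ← layer i 1≤i (<-trans (n<1+n i) i<D) = ≰⇒> λ ≤1 →
          <⇒≱ (subst (count (Above? i) <_) (sym (count-∖ C? cz))
                (s≤s (count-mono (Above? i) (C? ∖? z) λ w r → proj₁ r , λ { refl → <-irrefl (sym pz) (proj₂ r) })))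
              (min (aboveSide i 1≤i i<D cz pz (λ w cw pw → count-unique (At? i) ≤1 (cw , pw) (cz , pz))))

    Near? : ∀ a {C : Pred V 0ℓ} (C? : Decidable C) → Decidable (λ z → C z × d a z ≡ 1)
    Near? a C? z = C? z ×-dec (d a z ≟ℕ 1)

    -- Written with `+ 1` and `+ 0` to agree definitionally with `Low` for the level p = q + 1 seen
    -- from `b`.
    Beyond : V → V → Pred V 0ℓ → Pred V 0ℓ
    Beyond a b C z = (¬ C z × d b z + 1 < d a z + 0) × z ≢ b

    Beyond? : ∀ a b {C : Pred V 0ℓ} (C? : Decidable C) → Decidable (Beyond a b C)
    Beyond? a b C? z = (¬? (C? z) ×-dec (d b z + 1 <? d a z + 0)) ×-dec ¬? (z ≟ b)

    -- Oriented towards `b`: `t` is the vertex of the level p - q = 1, and `beyond` is the part past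
    -- it around `b`. The other end is described by the same record with the gates exchanged.
    record Analysis (a b : V) {C : Pred V 0ℓ} (C? : Decidable C) : Set where
      field
        side       : Side a b C?
        D≡3        : d a b ≡ 3
        count-C    : count C? ≡ 4
        count-near : count (Near? a C?) ≡ 2
        t          : V
        t∉C        : ¬ C t
        t-level    : d a t ≡ suc (d b t)
        t-unique   : ∀ {z} → ¬ C z → d a z ≡ suc (d b z) → z ≡ t
        beyond     : Side b t (Beyond? a b C?)
        count-beyond : m ≡ 4 + count (Beyond? a b C?)

    module _ (m≤9 : m ≤ 9) {a b : V} {C : Pred V 0ℓ} {C? : Decidable C} (S : Side a b C?)
      (min : Minimal (count C?)) where
      open TwoSided S hiding (Near?; count-near)

      private
        c = count C?
        lₐ = count (Near? a C?)
        l_b = count (Near? b C?)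

      -- A set too large to be a side has at least m vertices, which already exceeds |C|.
      minimal-≤ : ∀ {a′ b′ P} {P? : Decidable P} → (count P? < m → Side a′ b′ P?) → c ≤ count P?
      minimal-≤ {P? = P?} f with count P? <? m
      ... | yes lt = min (f lt)
      ... | no ≥m  = ≤-trans (<⇒≤ small) (≮⇒≥ ≥m)

      module _ (k l : ℕ) (parity : par k ≡ par (l + d a b)) (k<D+l : k < d a b + l) (l<D+k : l < d a b + k) where
        open Split ¬cycle S k l parity k<D+l l<D+k

        single⇒bounds : count Level? ≡ 1 → c ≤ count Low? × c ≤ count H.Low?
        single⇒bounds single = minimal-≤ (low single) , minimal-≤ (high single)

        opaque
          -- A level with one vertex leaves `C`, `Low` and `H.Low`, each of at least `c` vertices;
          -- the summand 3 counts `a`, `b` and the vertex of the level.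
          thick-level : 3 * c + 3 ≤ m + m ⊎ 2 ≤ count Level?
          thick-level with m≤n⇒m<n∨m≡n level-nonempty
          ... | inj₁ 2≤ = inj₂ 2≤
          ... | inj₂ 1≡ = inj₁ (arith c (count Low?) (count Level?) (count H.Low?) m (sym 1≡)
                (proj₁ (single⇒bounds (sym 1≡))) (proj₂ (single⇒bounds (sym 1≡))) count-split)
            where
            arith : ∀ c lo le hi m → le ≡ 1 → c ≤ lo → c ≤ hi → c + (suc lo + (le + suc hi)) ≡ m + m →
              3 * c + 3 ≤ m + m
            arith c lo le hi m refl h₁ h₂ h₃ = ≤-by 0 (+-mono-≤ (+-mono-≤ h₁ h₂) (≤-reflexive h₃)) (e c lo hi m)
              where
              e : ∀ c lo hi m → ((c + c) + (c + (suc lo + (1 + suc hi)))) + (m + m) ≡ (lo + hi + (m + m)) + (3 * c + 3)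
              e = solve-∀

      2≤lₐ : 2 ≤ lₐ
      2≤lₐ = layers-thick S min 1 ≤-refl (3≤D S)

      2≤l_b : 2 ≤ l_b
      2≤l_b = layers-thick (swap S) min 1 ≤-refl (3≤D (swap S))

      opaque
        -- If D ≥ 4, three disjoint layers give c ≥ 6, and the levels p - q = D - 2, D - 4, D - 6
        -- are all middle levels. A single vertex on one of them would need 3c + 3 ≤ 18. Otherwise
        -- they hold six vertices, and `count-mid-near` gives c ≥ 8, against c + 2 ≤ m ≤ 9.
        minimal⇒D≤3 : D ≤ 3
        minimal⇒D≤3 = ≮⇒≥ go
          where
          go : 4 ≤ D → ⊥
          go 4≤D = finish (thick-level 2 D (par0 2 refl) (lt 2 (from-yes (2 <? 8))) (gt 1))
                          (thick-level 4 D (par0 4 refl) (lt 4 (from-yes (4 <? 8))) (gt 3))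
                          (thick-level 6 D (par0 6 refl) (lt 6 (from-yes (6 <? 8))) (gt 5))
            where
            par0 : ∀ k → par k ≡ false → par k ≡ par (D + D)
            par0 k eq = trans eq (sym (par-double D))
            lt : ∀ k → k < 8 → k < D + D
            lt k k<8 = ≤-trans k<8 (+-mono-≤ 4≤D 4≤D)
            gt : ∀ k → D < D + suc k
            gt k = m<m+n D (s≤s z≤n)

            Lv? : ∀ k → Decidable (λ z → ¬ C z × p z + k ≡ q z + D)
            Lv? k z = ¬? (C? z) ×-dec (p z + k ≟ℕ q z + D)

            6≤c : 6 ≤ c
            6≤c = ≤-trans (+-mono-≤ 2≤l_b (+-mono-≤ 2≤lₐ (layers-thick S min 2 (s≤s z≤n) 4≤D)))
                   (≤-trans (+-monoʳ-≤ l_b (count-∪-≤ low? (At? S 1) (At? S 2) (λ _ → inj₁) (λ _ → inj₂)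
                       (λ { _ (_ , x) (_ , y) → contradiction (trans (sym x) y) λ () })))
                     (count-∪-≤ C? (Near? b C?) low? (λ _ → proj₁) (λ { _ (inj₁ x) → proj₁ x ; _ (inj₂ x) → proj₁ x })
                       (λ { _ (cz , qz) (inj₁ (_ , pz)) → far cz 1 pz qz (from-yes (2 <? 4))
                          ; _ (cz , qz) (inj₂ (_ , pz)) → far cz 2 pz qz (from-yes (3 <? 4)) })))
              where
              low? : Decidable (λ z → (C z × p z ≡ 1) ⊎ (C z × p z ≡ 2))
              low? z = At? S 1 z ⊎-dec At? S 2 z
              far : ∀ {z} → C z → ∀ i → p z ≡ i → q z ≡ 1 → i + 1 < 4 → ⊥
              far cz i pz qz i<3 = <⇒≱ i<3 (≤-trans 4≤D (≤-reflexive (trans (sym (layered cz)) (cong₂ _+_ pz qz))))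

            mid≥ : count (Lv? 2) + (count (Lv? 4) + count (Lv? 6)) ≤ count Mid?
            mid≥ = ≤-trans (+-monoʳ-≤ (count (Lv? 2)) (count-∪-≤ rest? (Lv? 4) (Lv? 6) (λ _ → inj₁) (λ _ → inj₂) (λ _ → apart 4 6 λ ())))
              (count-∪-≤ Mid? (Lv? 2) rest? (mid 1 refl (from-yes (2 <? 8)))
                 (λ { z (inj₁ x) → mid 3 refl (from-yes (4 <? 8)) z x
                    ; z (inj₂ x) → mid 5 refl (from-yes (6 <? 8)) z x })
                 (λ { _ x (inj₁ y) → apart 2 4 (λ ()) x y ; _ x (inj₂ y) → apart 2 6 (λ ()) x y }))
              where
              rest? : Decidable (λ z → (¬ C z × p z + 4 ≡ q z + D) ⊎ (¬ C z × p z + 6 ≡ q z + D))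
              rest? z = Lv? 4 z ⊎-dec Lv? 6 z
              apart : ∀ i j → i ≢ j → ∀ {z} → ¬ C z × p z + i ≡ q z + D → ¬ C z × p z + j ≡ q z + D → ⊥
              apart i j neq {z} (_ , x) (_ , y) = neq (+-cancelˡ-≡ (p z) i j (trans x (sym y)))
              mid : ∀ k → par (suc k) ≡ false → suc k < 8 → ∀ z → ¬ C z × p z + suc k ≡ q z + D → Mid z
              mid k even k<8 = Split.Level⇒Mid ¬cycle S (suc k) D (par0 (suc k) even) (lt (suc k) k<8) (gt k)

            thin-⊥ : 3 * c + 3 ≤ m + m → ⊥
            thin-⊥ h = ⊥-by 2 (+-mono-≤ (+-mono-≤ h (*-monoʳ-≤ 3 6≤c)) (+-mono-≤ m≤9 m≤9)) (e c m)
              where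
              e : ∀ c m → (3 * c + 3 + 18) + (m + m) ≡ suc (2 + ((m + m + 3 * c) + 18))
              e = solve-∀

            thick-⊥ : ∀ {x y z} → 2 ≤ x → 2 ≤ y → 2 ≤ z → x + (y + z) ≤ count Mid? → ⊥
            thick-⊥ {x} {y} {z} h₁ h₂ h₃ h₄ = ⊥-by 0
              (+-mono-≤ (+-mono-≤ (+-mono-≤ h₁ (+-mono-≤ h₂ h₃)) h₄)
                (+-mono-≤ (+-mono-≤ (+-mono-≤ 2≤lₐ 2≤l_b) count-mid-near) (+-mono-≤ (slack ¬cycle S) m≤9)))
              (e x y z (count Mid?) lₐ l_b c m)
              where
              e : ∀ x y z k l l′ c m → ((2 + (2 + 2)) + (x + (y + z))) + (((2 + 2) + (k + l + l′)) + (suc (suc c) + m))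
                ≡ suc (((x + (y + z)) + k) + (((l + l′) + (c + 2)) + (m + 9)))
              e = solve-∀

            finish : 3 * c + 3 ≤ m + m ⊎ 2 ≤ count (Lv? 2) → 3 * c + 3 ≤ m + m ⊎ 2 ≤ count (Lv? 4) →
              3 * c + 3 ≤ m + m ⊎ 2 ≤ count (Lv? 6) → ⊥
            finish (inj₁ h) _ _ = thin-⊥ h
            finish _ (inj₁ h) _ = thin-⊥ h
            finish _ _ (inj₁ h) = thin-⊥ h
            finish (inj₂ x) (inj₂ y) (inj₂ z) = thick-⊥ x y z mid≥

      minimal⇒D≡3 : D ≡ 3
      minimal⇒D≡3 = ≤-antisym minimal⇒D≤3 (3≤D S)

      private
        par3 : ∀ {k} → k ≡ 3 → par 0 ≡ par (1 + k)
        par3 eq = cong (λ x → par (1 + x)) (sym eq)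

        0<D+1 : ∀ {k} → k ≡ 3 → 0 < k + 1
        0<D+1 eq = subst (λ x → 0 < x + 1) (sym eq) (s≤s z≤n)

        1<D+0 : ∀ {k} → k ≡ 3 → 1 < k + 0
        1<D+0 eq = subst (λ x → 1 < x + 0) (sym eq) (s≤s (s≤s z≤n))

        D′≡3 : d b a ≡ 3
        D′≡3 = trans (d-sym b a) minimal⇒D≡3

      -- For D = 3 parity leaves the middle values 1 and -1 of p - q: `T` treats the first, and
      -- `T′`, with the gates exchanged, the second.
      module T = Split ¬cycle S 0 1 (par3 minimal⇒D≡3) (0<D+1 minimal⇒D≡3) (1<D+0 minimal⇒D≡3)
      module T′ = Split ¬cycle (swap S) 0 1 (par3 D′≡3) (0<D+1 D′≡3) (1<D+0 D′≡3)

      opaque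
        count-C-layers : c ≡ lₐ + l_b
        count-C-layers = count-≡-∪ C? (Near? a C?) (Near? b C?) split (λ _ → proj₁) (λ _ → proj₁)
            (λ { z (cz , pz) (_ , qz) → contradiction (trans (sym (sum cz)) (cong₂ _+_ pz qz)) λ () })
          where
          sum : ∀ {z} → C z → p z + q z ≡ 3
          sum cz = trans (layered cz) minimal⇒D≡3

          split : ∀ z → C z → (C z × p z ≡ 1) ⊎ (C z × q z ≡ 1)
          split z cz with m≤n⇒m<n∨m≡n (p-pos cz)
          ... | inj₂ eq = inj₁ (cz , sym eq)
          ... | inj₁ 2≤ = inj₂ (cz , ≤-antisym (≤-by 0 (+-mono-≤ 2≤ (≤-reflexive (sum cz))) (e (p z) (q z))) (q-pos cz))
            where
            e : ∀ p q → (2 + (p + q)) + 1 ≡ (p + 3) + q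
            e = solve-∀

        mid≥ : count T.Level? + count T′.Level? ≤ count Mid?
        mid≥ = count-∪-≤ Mid? T.Level? T′.Level? T.Level⇒Mid
          (λ z r → case T′.Level⇒Mid z r of λ { (x , y , w) → x , w , y })
          (λ z x y → apart (proj₂ x) (proj₂ y))
          where
          apart : ∀ {p q} → p + 0 ≡ q + 1 → q + 0 ≡ p + 1 → ⊥
          apart {p} {q} x y = ⊥-by 1 (≤-reflexive (sym (cong₂ _+_ x y))) (e p q)
            where
            e : ∀ p q → (q + 1) + (p + 1) ≡ suc (1 + ((p + 0) + (q + 0)))
            e = solve-∀

        -- `C` consists of its two end layers, so `count-mid-near` leaves at most two vertices for
        -- the middle, and neither level is empty.
        levels-single : count T.Level? ≡ 1 × count T′.Level? ≡ 1
        levels-single = ≤-antisym (arith T′.level-nonempty mid≥) T.level-nonempty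
                      , ≤-antisym (arith T.level-nonempty (subst (_≤ count Mid?) (+-comm (count T.Level?) _) mid≥)) T′.level-nonempty
          where
          arith : ∀ {x y} → 1 ≤ y → x + y ≤ count Mid? → x ≤ 1
          arith {x} {y} h₁ h₂ = ≤-by 0 (+-mono-≤ (+-mono-≤ h₁ h₂) (+-mono-≤ count-mid-near (≤-reflexive count-C-layers)))
              (e x y (count Mid?) lₐ l_b c)
            where
            e : ∀ x y k l l′ c → ((1 + (x + y)) + (k + l + l′ + c)) + 1 ≡ ((y + k) + (c + 2 + (l + l′))) + x
            e = solve-∀

        -- the level of t′ and everything beyond a lie below the level of t
        below : suc (count T′.H.Low?) ≤ count T.Low?
        below = subst (_≤ count T.Low?) (trans (cong (count T′.H.Low? +_) (proj₂ levels-single)) (+-comm _ 1))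
          (count-∪-≤ T.Low? T′.H.Low? T′.Level?
            (λ { z ((z∉ , lt) , z≢a) → (z∉ , ≤-by 2 lt (e₁ (p z) (q z))) , z≢a })
            (λ { z (z∉ , eq) → (z∉ , ≤-by 1 (≤-reflexive (sym eq)) (e₂ (p z) (q z)))
                             , λ { refl → contradiction (trans (sym D′≡3) (trans (sym (+-identityʳ _)) (trans eq (cong (_+ 1) (d-refl a))))) λ () } })
            λ { z ((_ , lt) , _) (_ , eq) → <-irrefl (sym eq) lt })
          where
          e₁ : ∀ p q → suc (p + 1) + (q + 1) ≡ 2 + ((q + 0) + suc (p + 0))
          e₁ = solve-∀
          e₂ : ∀ p q → (p + 1) + (q + 1) ≡ 1 + ((q + 0) + suc (p + 0))
          e₂ = solve-∀

      private
        lo = count T.Low?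
        hi = count T.H.Low?
        hi′ = count T′.H.Low?

      opaque
        total : c + (suc lo + (1 + suc hi)) ≡ m + m
        total = trans (cong (λ x → c + (suc lo + (x + suc hi))) (sym (proj₁ levels-single))) T.count-split

        c≤hi : c ≤ hi
        c≤hi = minimal-≤ (T.high (proj₁ levels-single))

        c≤hi′ : c ≤ hi′
        c≤hi′ = minimal-≤ (T′.high (proj₂ levels-single))

        -- By `total`, c + lo + hi + 3 = 2m. With lo ≥ c + 1 and hi ≥ c this yields 3c + 4 ≤ 18;
        -- conversely `C` has two layers of at least two vertices.
        c≡4 : c ≡ 4
        c≡4 = ≤-antisym (≤-pred (*-cancelˡ-< 3 c 5 (≤-by 0
              (+-mono-≤ (+-mono-≤ (+-mono-≤ c≤hi c≤hi′) below) (+-mono-≤ (≤-reflexive total) (+-mono-≤ m≤9 m≤9)))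
              (e c hi hi′ lo m))))
            (subst (4 ≤_) (sym count-C-layers) (+-mono-≤ 2≤lₐ 2≤l_b))
          where
          e : ∀ c hi hi′ lo m → (((c + c) + suc hi′) + (c + (suc lo + (1 + suc hi)) + (m + m))) + 3 * 5
            ≡ 0 + ((((hi + hi′) + lo) + ((m + m) + 18)) + suc (3 * c))
          e = solve-∀

        lₐ≡2 : lₐ ≡ 2
        lₐ≡2 = ≤-antisym (≤-by 0 (+-mono-≤ 2≤l_b (≤-reflexive (trans (sym count-C-layers) c≡4))) (e lₐ l_b)) 2≤lₐ
          where
          e : ∀ l l′ → (2 + (l + l′)) + 2 ≡ (l′ + 4) + l
          e = solve-∀

        m≤4+hi : m ≤ 4 + hi
        m≤4+hi = arith (+-mono-≤ (+-mono-≤ 2≤lₐ (≤-reflexive c≡4)) (+-mono-≤ (SideProps.count-near S)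
            (≤-trans (count-mono Far? T.H.X? (λ _ → T.H.Op-Far⇒X (1<D+0 D′≡3))) (≤-reflexive (count-∖ T.H.X? (T.H.a∈X (1<D+0 D′≡3)))))))
          where
          arith : ∀ {f} → (2 + c) + (m + lₐ + f) ≤ (lₐ + 4) + (c + f + 1 + suc hi) → m ≤ 4 + hi
          arith {f} h = ≤-by 0 h (e m lₐ c f hi)
            where
            e : ∀ m l c f hi → (2 + c) + (m + l + f) + (4 + hi) ≡ ((l + 4) + (c + f + 1 + suc hi)) + m
            e = solve-∀

        m≤4+hi′ : m ≤ 4 + hi′
        m≤4+hi′ = arith (+-mono-≤ (+-mono-≤ 2≤l_b (≤-reflexive c≡4)) (+-mono-≤ Op.count-near
            (≤-trans (count-mono Op.Far? T′.H.X? (λ _ → T′.H.Op-Far⇒X (1<D+0 minimal⇒D≡3))) (≤-reflexive (count-∖ T′.H.X? (T′.H.a∈X (1<D+0 minimal⇒D≡3)))))))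
          where
          arith : ∀ {f} → (2 + c) + (m + l_b + f) ≤ (l_b + 4) + (c + f + 1 + suc hi′) → m ≤ 4 + hi′
          arith {f} h = ≤-by 0 h (e m l_b c f hi′)
            where
            e : ∀ m l c f hi → (2 + c) + (m + l + f) + (4 + hi) ≡ ((l + 4) + (c + f + 1 + suc hi)) + m
            e = solve-∀

        -- `count-near` at each gate bounds m by 4 + hi and by 4 + hi′, while `total` and `below`
        -- give hi + hi′ + 8 ≤ 2m.
        m≡4+hi : m ≡ 4 + hi
        m≡4+hi = ≤-antisym m≤4+hi (≤-by 0 (+-mono-≤ (+-mono-≤ m≤4+hi′ below) (+-mono-≤ (≤-reflexive total) (≤-reflexive (sym c≡4)))) (e m c lo hi hi′))
          where
          e : ∀ m c lo hi hi′ → ((m + suc hi′) + (c + (suc lo + (1 + suc hi)) + 4)) + m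
            ≡ 0 + ((((4 + hi′) + lo) + (m + m + c)) + (4 + hi))
          e = solve-∀

      opaque
        analyse : Analysis a b C?
        analyse = record
          { side = S ; D≡3 = minimal⇒D≡3 ; count-C = c≡4 ; count-near = lₐ≡2
          ; t = T.t single ; t∉C = proj₁ (T.t-level single)
          ; t-level = trans (sym (+-identityʳ _)) (trans (proj₂ (T.t-level single)) (+-comm _ 1))
          ; t-unique = λ {z} z∉ eq → T.level≡t single z (z∉ , trans (+-identityʳ _) (trans eq (+-comm 1 _)))
          ; beyond = T.high single (subst (suc hi ≤_) (sym m≡4+hi) (s≤s (m≤n+m hi 3)))
          ; count-beyond = m≡4+hi }
          where
          single : count T.Level? ≡ 1
          single = proj₁ levels-single

    -- Zones around a minimal side.

    module Block {a b : V} {C : Pred V 0ℓ} {C? : Decidable C} (F : Analysis a b C?) where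
      open Analysis F
      open SideProps side using (p; q; closed; layered; p-pos; q-pos)

      p+q≡3 : ∀ {z} → C z → p z + q z ≡ 3
      p+q≡3 c = trans (layered c) D≡3

      near-or-near : ∀ {z} → C z → (C z × p z ≡ 1) ⊎ (C z × q z ≡ 1)
      near-or-near {z} c with p z in pz | q z in qz | p+q≡3 c | p-pos c | q-pos c
      ... | 1 | _ | _ | _ | _ = inj₁ (c , refl)
      ... | 2 | 1 | _ | _ | _ = inj₂ (c , refl)
      ... | 3 | 0 | _ | _ | ()

      near-nbr : ∀ {z w} → C z × p z ≡ 1 → Adj z w → w ≡ a ⊎ (C w × q w ≡ 1)
      near-nbr {z} {w} (c , pz) e with closed c e
      ... | inj₂ (inj₁ eq) = inj₁ eq
      ... | inj₂ (inj₂ refl) = contradiction (trans (sym (p+q≡3 c)) (cong₂ _+_ pz (adj⇒d≡1 (adj-swap e)))) λ ()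
      ... | inj₁ cw with near-or-near cw
      ...   | inj₁ (_ , pw) = contradiction (trans pz (sym pw)) (adj-d-≢ a e)
      ...   | inj₂ r = inj₂ r

      opaque
        -- The difference p - q is odd, exceeds 1 and is at most D = 3.
        beyond-far : ∀ {z} → Beyond a b C z → p z ≡ 3 + q z
        beyond-far {z} ((_ , lt) , _) = ≤-antisym
          (subst (λ k → p z ≤ k + q z) D≡3 (d-tri a b z))
          (subst₂ _<_ (+-comm (q z) 2) (+-identityʳ (p z)) (≤∧≢⇒< (subst (_≤ p z + 0) (sym (+-suc (q z) 1)) lt)
            λ eq → Levels.gap (swap side) 1 0 (cong par (sym (trans (d-sym b a) D≡3))) z (trans (sym (+-suc (q z) 1)) eq)))

      opaque
        p≢q : ∀ z → p z ≢ q z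
        p≢q z eq = Levels.gap side 0 1 (cong (λ x → par (1 + x)) (sym D≡3)) z
          (trans (cong suc (+-identityʳ (p z))) (trans (cong suc eq) (+-comm 1 (q z))))

      beyond-intro : ∀ {z} → ¬ C z → suc (q z) < p z → z ≢ b → Beyond a b C z
      beyond-intro {z} z∉ lt z≢b = (z∉ , subst₂ _<_ (+-comm 1 (q z)) (sym (+-identityʳ (p z))) lt) , z≢b

      t≢a : t ≢ a
      t≢a eq = contradiction (trans (sym (d-refl a)) (trans (cong p (sym eq)) t-level)) λ ()

      t≢b : t ≢ b
      t≢b eq = contradiction (trans (sym D≡3) (trans (cong p (sym eq)) (trans t-level (cong suc (trans (cong q eq) (d-refl b)))))) λ ()

      ¬adj-t-C : ∀ {w} → Adj t w → ¬ C w
      ¬adj-t-C e cw with closed cw (adj-swap e)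
      ... | inj₁ ct = t∉C ct
      ... | inj₂ (inj₁ eq) = t≢a eq
      ... | inj₂ (inj₂ eq) = t≢b eq

    module End {a b : V} {C : Pred V 0ℓ} {C? : Decidable C} (F : Analysis a b C?) (F′ : Analysis b a C?) where
      open Analysis F
      open Analysis F′ using () renaming (t to t′; t-unique to t′-unique;
        beyond to beyond′; count-beyond to count-beyond′; D≡3 to D′≡3)
      module K = Block F
      module K′ = Block F′

      p q : V → ℕ
      p = d a
      q = d b

      A B : Pred V 0ℓ
      A = Beyond b a C
      B = Beyond a b C

      A? : Decidable A
      A? = Beyond? b a C?

      B? : Decidable B
      B? = Beyond? a b C?

      data Zone (z : V) : Set where
        in-C : C z → Zone z
        at-a : z ≡ a → Zone z
        at-b : z ≡ b → Zone z
        in-A : A z → Zone z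
        in-B : B z → Zone z
        at-t : z ≡ t → Zone z
        at-t′ : z ≡ t′ → Zone z

      opaque
        zone : ∀ z → Zone z
        zone z with C? z
        ... | yes c = in-C c
        ... | no z∉ with z ≟ a | z ≟ b
        ...   | yes eq | _ = at-a eq
        ...   | no _ | yes eq = at-b eq
        ...   | no z≢a | no z≢b with <-cmp (p z) (q z)
        ...     | tri≈ _ eq _ = contradiction eq (K.p≢q z)
        ...     | tri< lt _ _ with m≤n⇒m<n∨m≡n lt
        ...       | inj₁ lt′ = in-A (K′.beyond-intro z∉ lt′ z≢a)
        ...       | inj₂ eq = at-t′ (t′-unique z∉ (sym eq))
        zone z | no z∉ | no z≢a | no z≢b | tri> _ _ gt with m≤n⇒m<n∨m≡n gt
        ...       | inj₁ gt′ = in-B (K.beyond-intro z∉ gt′ z≢b)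
        ...       | inj₂ eq = at-t (t-unique z∉ (sym eq))

      3≤qt : 3 ≤ q t
      3≤qt = 3≤D beyond

      -- The difference p - q is 1 at `t` and -3 on `A`, too far apart for an edge.
      adj-t-A : ∀ {w} → Adj t w → ¬ A w
      adj-t-A {w} e aw = ⊥-by 1 (+-mono-≤ (d-lip b (adj-swap e)) (d-lip a e))
          (trans (cong₂ _+_ (K′.beyond-far aw) t-level) (eq (p w) (q t)))
        where
        eq : ∀ x y → (3 + x) + suc y ≡ suc (1 + (suc y + suc x))
        eq = solve-∀

      opaque
        -- The vertex sought is the first one, `w`, on a geodesic from `t` to `a`, where p w = q t.
        -- If `w` were in `B`, then p w = q w + 3, although q t ≤ q w + 1; the other zones have no
        -- suitable neighbour of `t`.
        t-t′ : Adj t t′ × d a t′ ≡ d b t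
        t-t′ with w , e , pw ← d-pred a t t-level with zone w
        ... | in-C c = contradiction c (K.¬adj-t-C e)
        ... | at-a refl = contradiction (subst (3 ≤_) (trans (sym pw) (d-refl a)) 3≤qt) λ ()
        ... | at-b refl = contradiction (subst (3 ≤_) (adj⇒d≡1 (adj-swap e)) 3≤qt) λ { (s≤s ()) }
        ... | in-A aw = contradiction aw (adj-t-A e)
        ... | in-B bw = ⊥-elim (⊥-by 1 (d-lip b e) (trans (sym pw) (K.beyond-far bw)))
        ... | at-t refl = contradiction refl (adj⇒≢ e)
        ... | at-t′ refl = e , pw

      private
        module PA = TwoSided beyond′
        module PB = TwoSided beyond

        rest? : Decidable (λ z → A z × d t′ z ≢ 1)
        rest? z = A? z ×-dec ¬? (d t′ z ≟ℕ 1)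

        A∩B : ∀ {z} → A z → B z → ⊥
        A∩B {z} az bz = ⊥-by 5 (≤-reflexive (trans (sym (cong (3 +_) (K.beyond-far bz))) (sym (K′.beyond-far az)))) refl

        -- A geodesic from `z` to `t` leaves `A` through `t′`, with one more step to go, or through
        -- `a`. In the latter case p t = 1 + d(a, t′) = 1 + p z + d(t′, z) is already long enough.
        far-from-t : ∀ {z} → A z → suc (d t′ z) ≤ d t z
        far-from-t {z} az with PA.gate (inj₁ az) {t} (λ at → ⊥-by 3 (≤-reflexive (sym t-level)) (cong suc (K′.beyond-far at)))
        ... | inj₁ h = begin
            suc (d t′ z)  ≤⟨ s≤s (m≤n+m (d t′ z) (p z)) ⟩
            suc (p z + d t′ z)  ≡⟨ cong suc (PA.layered az) ⟩
            suc (d a t′)  ≡⟨ cong suc (proj₂ t-t′) ⟩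
            suc (q t)     ≡⟨ t-level ⟨
            p t           ≤⟨ m≤n+m (p t) (p z) ⟩
            p z + p t     ≡⟨ h ⟨
            d z t         ≡⟨ d-sym z t ⟩
            d t z         ∎
          where open ≤-Reasoning
        ... | inj₂ h = ≤-reflexive (trans (+-comm 1 (d t′ z)) (trans (cong (d t′ z +_) (sym (adj⇒d≡1 (adj-swap (proj₁ t-t′))))) (trans (sym h) (d-sym z t))))

        rest⇒Mid : ∀ z → A z × d t′ z ≢ 1 → PB.Mid z
        rest⇒Mid z (az , neq) = A∩B az
          , (λ { (_ , far) → not-far sum (≤∧≢⇒< (PA.q-pos az) (neq ∘ sym)) (far-from-t az) (trans (sym (K′.beyond-far az)) far) })
          , (λ { (_ , far) → not-op-far sum lip (trans far (cong₂ _+_ (K′.beyond-far az) (d-sym t b))) })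
          where
          sum : p z + d t′ z ≡ q t
          sum = trans (PA.layered az) (proj₂ t-t′)

          lip : d t z ≤ suc (d t′ z)
          lip = subst₂ (λ x y → x ≤ suc y) (d-sym z t) (d-sym z t′) (d-lip z (proj₁ t-t′))

          -- With `i` = p z, `j` = d(t′, z) and `x` = d(t, z), being far would give 2j ≤ 2; this is
          -- where the last layer of `A` has to be left out.
          not-far : ∀ {i j e x} → i + j ≡ e → 2 ≤ j → suc j ≤ x → 3 + i ≡ x + e → ⊥
          not-far {i} {j} {_} {x} refl h₁ h₂ h₃ =
            ⊥-by 1 (+-mono-≤ (+-mono-≤ h₁ h₁) (+-mono-≤ h₂ (≤-reflexive (sym h₃)))) (eq i j x)
            where
            eq : ∀ i j x → (2 + 2) + (suc j + (x + (i + j))) ≡ suc (1 + ((j + j) + (x + (3 + i))))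
            eq = solve-∀

          not-op-far : ∀ {i j e x} → i + j ≡ e → x ≤ suc j → x ≡ 3 + i + e → ⊥
          not-op-far {i} {j} refl h refl = ⊥-by (i + i + 1) h (eq i j)
            where
            eq : ∀ i j → 3 + i + (i + j) ≡ suc (i + i + 1 + suc j)
            eq = solve-∀

        a-Mid : PB.Mid a
        a-Mid = (λ ba → contradiction (trans (sym (d-refl a)) (K.beyond-far ba)) λ ())
          , (λ { (_ , far) → <⇒≱ (≤-trans (m≤m+n (suc (q t)) (q t))
                   (≤-reflexive (trans (cong (_+ q t) (sym dta)) (trans (sym far) D′≡3)))) 3≤qt })
          , (λ { (_ , far) → ⊥-by 1 (≤-reflexive (trans (cong₂ _+_ (sym D′≡3) (d-sym b t)) (trans (sym far) dta))) refl })
          where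
          dta : d t a ≡ suc (q t)
          dta = trans (d-sym t a) t-level

      -- a and all of A except its last layer lie on middle levels of the cut {b, t}
      opaque
        near-inequality : count (Near? b B?) + count (Near? t B?) ≤ 1 + count (Near? t′ A?)
        -- The two `count-beyond` equations give |A| = |B| = m - 4, so the sizes of `A` and `B`
        -- cancel.
        near-inequality = arith mid-lower PB.count-mid-near split (suc-injective (suc-injective (suc-injective (suc-injective
            (trans (sym count-beyond′) count-beyond)))))
          where
          mid-lower : 1 + count rest? ≤ count PB.Mid?
          mid-lower = subst (λ x → x + count rest? ≤ count PB.Mid?) (count-singleton a)
            (count-∪-≤ PB.Mid? (_≟ a) rest? (λ { _ refl → a-Mid }) rest⇒Mid (λ { _ refl (aa , _) → proj₂ aa refl }))

          split : count A? ≡ count (Near? t′ A?) + count rest?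
          split = count-≡-∪ A? (Near? t′ A?) rest? decide (λ _ → proj₁) (λ _ → proj₁) (λ _ x y → proj₂ y (proj₂ x))
            where
            decide : ∀ z → A z → (A z × d t′ z ≡ 1) ⊎ (A z × d t′ z ≢ 1)
            decide z az with d t′ z ≟ℕ 1
            ... | yes eq = inj₁ (az , eq)
            ... | no neq = inj₂ (az , neq)

          arith : ∀ {r k l l′ x y w} → 1 + r ≤ k → k + l + l′ ≤ y + 2 → x ≡ w + r → x ≡ y → l + l′ ≤ 1 + w
          arith {r} {k} {l} {l′} {x} {y} {w} h₁ h₂ h₃ refl = ≤-by 0 (+-mono-≤ (+-mono-≤ h₁ h₂) (≤-reflexive h₃)) (eq r k l l′ x w)
            where
            eq : ∀ r k l l′ x w → ((1 + r) + (k + l + l′) + x) + (1 + w) ≡ ((k + (x + 2)) + (w + r)) + (l + l′)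
            eq = solve-∀

    module Tail (m≤9 : m ≤ 9) {a b : V} {C : Pred V 0ℓ} {C? : Decidable C}
      (F : Analysis a b C?) (F′ : Analysis b a C?) (min : Minimal (count C?)) where
      open Analysis F
      open Analysis F′ using () renaming (t to t′; D≡3 to D′≡3)
      open End F F′

      private
        module PB = TwoSided beyond

      opaque
        -- Adding the inequalities of both ends cancels the layers next to `t` and `t′`: the layers
        -- next to `a` and `b` have at most two vertices together, and the one next to `a` is
        -- nonempty.
        near-b≤1 : count (Near? b B?) ≤ 1
        near-b≤1 = ≤-by 0 (+-mono-≤ (+-mono-≤ near-inequality (End.near-inequality F′ F))
            (count-pos (Near? a A?) (proj₂ (SideProps.near (Analysis.beyond F′)))))
          (eq (count (Near? b B?)) (count (Near? t B?)) (count (Near? a A?)) (count (Near? t′ A?)))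
          where
          eq : ∀ nb nt na nt′ → (((nb + nt) + (na + nt′)) + 1) + 1 ≡ (((1 + nt′) + (1 + nt)) + na) + nb
          eq = solve-∀

      c : V
      c = proj₁ PB.near

      c∈B : B c
      c∈B = proj₁ (proj₂ PB.near)

      qc : q c ≡ 1
      qc = proj₂ (proj₂ PB.near)

      c-unique : ∀ z → B z → q z ≡ 1 → z ≡ c
      c-unique z bz qz = count-unique (Near? b B?) near-b≤1 (bz , qz) (c∈B , qc)

      B′ : Pred V 0ℓ
      B′ z = B z × 1 < q z

      B′? : Decidable B′
      B′? = Above? beyond 1

      S₂ : Side c t B′?
      S₂ = aboveSide beyond 1 ≤-refl (3≤D beyond) c∈B qc c-unique

      B-cover : ∀ z → B z → z ≡ c ⊎ B′ z
      B-cover z bz with m≤n⇒m<n∨m≡n (PB.p-pos bz)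
      ... | inj₁ lt = inj₂ (bz , lt)
      ... | inj₂ eq = inj₁ (c-unique z bz (sym eq))

      opaque
        m≡5+ : m ≡ 5 + count B′?
        m≡5+ = trans count-beyond (cong (4 +_) (trans (count-≡-∪ B? (_≟ c) B′? B-cover (λ { _ refl → c∈B }) (λ _ → proj₁)
                 (λ { _ refl (_ , lt) → <-irrefl (sym qc) lt })) (cong (_+ count B′?) (count-singleton c))))

        -- Without `c`, the set `B` is a side of m - 5 ≤ 4 vertices, and minimality asks for at
        -- least 4. So m = 9, and this side is minimal again, open to the same analysis.
        count-B′ : count B′? ≡ 4
        count-B′ = ≤-antisym (+-cancelˡ-≤ 5 _ 4 (subst (_≤ 9) m≡5+ m≤9)) (subst (_≤ count B′?) count-C (min S₂))

        m≡9 : m ≡ 9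
        m≡9 = trans m≡5+ (cong (5 +_) count-B′)

      min₂ : Minimal (count B′?)
      min₂ S = subst (_≤ _) (trans count-C (sym count-B′)) (min S)

      F₂ : Analysis c t B′?
      F₂ = analyse m≤9 S₂ min₂

      F₂′ : Analysis t c B′?
      F₂′ = analyse m≤9 (swap S₂) min₂

      opaque
        nbr-b : ∀ {w} → Adj b w → w ≡ c ⊎ (C w × q w ≡ 1)
        nbr-b {w} e with adj⇒d≡1 e | zone w
        ... | qw | in-C cw = inj₂ (cw , qw)
        ... | qw | at-a refl = contradiction (trans (sym D′≡3) qw) λ ()
        ... | qw | at-b refl = contradiction refl (adj⇒≢ e)
        ... | qw | in-A aw = contradiction (trans (sym (K′.beyond-far aw)) qw) λ ()
        ... | qw | in-B bw = inj₁ (c-unique w bw qw)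
        ... | qw | at-t refl = contradiction (subst (3 ≤_) qw 3≤qt) λ { (s≤s ()) }
        ... | qw | at-t′ refl = contradiction (subst (3 ≤_) (suc-injective (trans (sym (Analysis.t-level F′)) qw)) (3≤D (Analysis.beyond F′))) λ ()

        nbr-c : ∀ {w} → Adj c w → w ≡ b ⊎ (B′ w × d c w ≡ 1)
        nbr-c {w} e with PB.closed c∈B e
        ... | inj₂ (inj₁ eq) = inj₁ eq
        ... | inj₂ (inj₂ refl) = contradiction (trans (sym (Analysis.D≡3 F₂)) (adj⇒d≡1 e)) λ ()
        ... | inj₁ bw with B-cover w bw
        ...   | inj₁ refl = contradiction refl (adj⇒≢ e)
        ...   | inj₂ b′w = inj₂ (b′w , adj⇒d≡1 e)

        nbr-t : ∀ {w} → Adj t w → w ≡ t′ ⊎ (B′ w × d t w ≡ 1)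
        nbr-t {w} e with zone w
        ... | in-C cw = contradiction cw (K.¬adj-t-C e)
        ... | at-a refl = contradiction (trans (sym (adj⇒d≡1 (adj-swap e))) t-level) λ eq →
              contradiction (subst (3 ≤_) (sym (suc-injective eq)) 3≤qt) λ ()
        ... | at-b refl = contradiction (subst (3 ≤_) (adj⇒d≡1 (adj-swap e)) 3≤qt) λ { (s≤s ()) }
        ... | in-A aw = contradiction aw (adj-t-A e)
        ... | at-t refl = contradiction refl (adj⇒≢ e)
        ... | at-t′ eq = inj₁ eq
        ... | in-B bw with B-cover w bw
        ...   | inj₁ refl = contradiction (trans (sym (Analysis.D≡3 F₂)) (adj⇒d≡1 (adj-swap e))) λ ()
        ...   | inj₂ b′w = inj₂ (b′w , adj⇒d≡1 e)

    -- Assembling the ring of three bricks.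

    OneOf : V → V → V → Pred V 0ℓ
    OneOf x y z w = w ≡ x ⊎ w ≡ y ⊎ w ≡ z

    -- K₃,₃ minus the edge a b, with parts {a, y₁, y₂} and {b, x₁, x₂}
    record Brick (a b : V) (C : Pred V 0ℓ) : Set where
      field
        x₁ x₂ y₁ y₂ : V
        near-a : ∀ {z} → C z → d a z ≡ 1 → z ≡ x₁ ⊎ z ≡ x₂
        near-b : ∀ {z} → C z → d b z ≡ 1 → z ≡ y₁ ⊎ z ≡ y₂
        nbr-x₁ : ∀ {w} → Adj x₁ w → OneOf a y₁ y₂ w
        nbr-x₂ : ∀ {w} → Adj x₂ w → OneOf a y₁ y₂ w
        nbr-y₁ : ∀ {w} → Adj y₁ w → OneOf b x₁ x₂ w
        nbr-y₂ : ∀ {w} → Adj y₂ w → OneOf b x₁ x₂ w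
        cover  : ∀ {z} → C z → (z ≡ x₁ ⊎ z ≡ x₂) ⊎ (z ≡ y₁ ⊎ z ≡ y₂)

    module _ {a b : V} {C : Pred V 0ℓ} {C? : Decidable C} (F : Analysis a b C?) (F′ : Analysis b a C?) where

      opaque
        brick : Brick a b C
        brick
          with x₁ , x₂ , nx₁ , nx₂ , nx ← count-two (Near? a C?) (Analysis.count-near F)
             | y₁ , y₂ , ny₁ , ny₂ , ny ← count-two (Near? b C?) (Analysis.count-near F′) = record
          { x₁ = x₁ ; x₂ = x₂ ; y₁ = y₁ ; y₂ = y₂
          ; near-a = λ c e → nx _ (c , e)
          ; near-b = λ c e → ny _ (c , e)
          ; nbr-x₁ = λ e → map₂ (ny _) (Block.near-nbr F nx₁ e)
          ; nbr-x₂ = λ e → map₂ (ny _) (Block.near-nbr F nx₂ e)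
          ; nbr-y₁ = λ e → map₂ (nx _) (Block.near-nbr F′ ny₁ e)
          ; nbr-y₂ = λ e → map₂ (nx _) (Block.near-nbr F′ ny₂ e)
          ; cover  = λ c → map⊎ (nx _) (ny _) (Block.near-or-near F c) }

    -- The arc of the ring that leaves `C` at `b`, enters the next brick at `c`, leaves it at `t`
    -- and goes on to `t′`.
    record Wing (b t t′ : V) (C B : Pred V 0ℓ) : Set₁ where
      field
        {B′}  : Pred V 0ℓ
        c     : V
        block : Brick c t B′
        nbr-b : ∀ {w} → Adj b w → w ≡ c ⊎ (C w × d b w ≡ 1)
        nbr-c : ∀ {w} → Adj c w → OneOf b (Brick.x₁ block) (Brick.x₂ block) w
        nbr-t : ∀ {w} → Adj t w → OneOf t′ (Brick.y₁ block) (Brick.y₂ block) w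
        cover : ∀ {z} → B z → z ≡ c ⊎ B′ z

    module _ (m≤9 : m ≤ 9) {a b : V} {C : Pred V 0ℓ} {C? : Decidable C}
      (F : Analysis a b C?) (F′ : Analysis b a C?) (min : Minimal (count C?)) where

      opaque
        wing : Wing b (Analysis.t F) (Analysis.t F′) C (Beyond a b C)
        wing = build (brick F₂ F₂′)
          where
          open Tail m≤9 F F′ min
          build : Brick c (Analysis.t F) B′ → Wing b (Analysis.t F) (Analysis.t F′) C (Beyond a b C)
          build K = record
            { c = c ; block = K ; nbr-b = nbr-b ; cover = λ {z} → B-cover z
            ; nbr-c = λ e → map₂ (λ r → Brick.near-a K (proj₁ r) (proj₂ r)) (nbr-c e)
            ; nbr-t = λ e → map₂ (λ r → Brick.near-b K (proj₁ r) (proj₂ r)) (nbr-t e) }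

    module _ {a b t t′ : V} {C A B : Pred V 0ℓ} (K : Brick a b C)
      (R : Wing b t t′ C B) (L : Wing a t′ t C A)
      (zones : ∀ z → C z ⊎ A z ⊎ B z ⊎ z ≡ a ⊎ z ≡ b ⊎ z ≡ t ⊎ z ≡ t′) where

      private
        module K = Brick K
        module R = Wing R
        module L = Wing L
        module RB = Brick R.block
        module LB = Brick L.block

        -- The left wing runs from `a` to `t′`, against the numbering, so its brick is listed in
        -- reverse.
        at : Fin 18 → V
        at = lookup (a ∷ K.x₁ ∷ K.x₂ ∷ K.y₁ ∷ K.y₂ ∷ b ∷
                     R.c ∷ RB.x₁ ∷ RB.x₂ ∷ RB.y₁ ∷ RB.y₂ ∷ t ∷
                     t′ ∷ LB.y₁ ∷ LB.y₂ ∷ LB.x₁ ∷ LB.x₂ ∷ L.c ∷ [])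

        nbr : ∀ i {w} → Adj (at i) w → OneOf (at (N₁ i)) (at (N₂ i)) (at (N₃ i)) w
        nbr 0F e = map₂ (λ r → K.near-a (proj₁ r) (proj₂ r)) (L.nbr-b e)
        nbr 1F e = K.nbr-x₁ e
        nbr 2F e = K.nbr-x₂ e
        nbr 3F e = K.nbr-y₁ e
        nbr 4F e = K.nbr-y₂ e
        nbr 5F e = map₂ (λ r → K.near-b (proj₁ r) (proj₂ r)) (R.nbr-b e)
        nbr 6F e = R.nbr-c e
        nbr 7F e = RB.nbr-x₁ e
        nbr 8F e = RB.nbr-x₂ e
        nbr 9F e = RB.nbr-y₁ e
        nbr 10F e = RB.nbr-y₂ e
        nbr 11F e = R.nbr-t e
        nbr 12F e = L.nbr-t e
        nbr 13F e = LB.nbr-y₁ e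
        nbr 14F e = LB.nbr-y₂ e
        nbr 15F e = LB.nbr-x₁ e
        nbr 16F e = LB.nbr-x₂ e
        nbr 17F e = L.nbr-c e

        one : ∀ i {z} → z ≡ at i → ∃ λ k → at k ≡ z
        one i eq = i , sym eq

        two : ∀ i j {z} → z ≡ at i ⊎ z ≡ at j → ∃ λ k → at k ≡ z
        two i j = [ one i , one j ]′

        four : ∀ i j k l {z} → (z ≡ at i ⊎ z ≡ at j) ⊎ (z ≡ at k ⊎ z ≡ at l) → ∃ λ k → at k ≡ z
        four i j k l = [ two i j , two k l ]′

        onto : ∀ z → ∃ λ i → at i ≡ z
        onto z = [ (λ cz → four 1F 2F 3F 4F (K.cover cz))
                 , [ (λ az → [ one 17F , (λ r → four 15F 16F 13F 14F (LB.cover r)) ]′ (L.cover az))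
                   , [ (λ bz → [ one 6F , (λ r → four 7F 8F 9F 10F (RB.cover r)) ]′ (R.cover bz))
                     , [ one 0F , [ one 5F , [ one 11F , one 12F ]′ ]′ ]′ ]′ ]′ ]′ (zones z)

      layoutOf : Layout G
      layoutOf = record { at = at ; onto = onto ; nbr = nbr }

    module _ (m≤9 : m ≤ 9) (M : MinSide) where
      open MinSide M

      private
        F : Analysis a b C?
        F = analyse m≤9 side minimal

        F′ : Analysis b a C?
        F′ = analyse m≤9 (swap side) minimal

        zones : ∀ z → C z ⊎ Beyond b a C z ⊎ Beyond a b C z ⊎ z ≡ a ⊎ z ≡ b ⊎ z ≡ Analysis.t F ⊎ z ≡ Analysis.t F′
        zones z = go (End.zone F F′ z)
          where
          open End F F′ using (in-C; in-A; in-B; at-a; at-b; at-t; at-t′; Zone)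
          go : Zone z → _
          go (in-C x) = inj₁ x
          go (in-A x) = inj₂ (inj₁ x)
          go (in-B x) = inj₂ (inj₂ (inj₁ x))
          go (at-a x) = inj₂ (inj₂ (inj₂ (inj₁ x)))
          go (at-b x) = inj₂ (inj₂ (inj₂ (inj₂ (inj₁ x))))
          go (at-t x) = inj₂ (inj₂ (inj₂ (inj₂ (inj₂ (inj₁ x)))))
          go (at-t′ x) = inj₂ (inj₂ (inj₂ (inj₂ (inj₂ (inj₂ x)))))

      layout : Layout G
      layout = layoutOf (brick F F′) (wing m≤9 F F′ minimal) (wing m≤9 F′ F minimal) zones

      order-18 : n ≡ 18
      order-18 = trans n≡m+m (cong₂ _+_ (Tail.m≡9 m≤9 F F′ minimal) (Tail.m≡9 m≤9 F F′ minimal))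

-- W(2,3) is admissible.

W23 : Graph 18
W23 = record
  { adj = λ i j → ⌊ Nbr? i j ⌋
  ; sym = from-yes (all? λ i → all? λ j → ⌊ Nbr? i j ⌋ ≟ᵇ ⌊ Nbr? j i ⌋)
  ; irrefl = from-yes (all? λ i → ⌊ Nbr? i i ⌋ ≟ᵇ false) }

W23-adj : ∀ {i j} → adj W23 i j ≡ true → Nbr i j
W23-adj {i} {j} e with Nbr? i j
... | yes h = h

W23-adj⁻ : ∀ {i j} → Nbr i j → adj W23 i j ≡ true
W23-adj⁻ {i} {j} h with Nbr? i j
... | yes _ = refl
... | no ¬h = contradiction h ¬h

W23-iso : IsoTo W23 W23V W23Adj
W23-iso = Fin18↔W23V , λ i j → mk⇔
  (λ e → Nbr⇒W23Adj i j (W23-adj {i} {j} e)) (λ h → W23-adj⁻ {i} {j} (W23Adj⇒Nbr i j h))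

-- vertices in the same layer are at distance 2, others as far apart as their layers in the 12-cycle
D23 : Fin 18 → Fin 18 → ℕ
D23 u v = if ⌊ u ≟ v ⌋ then 0 else (case ∣ layerOf u - layerOf v ∣ of λ { 0 → 2 ; k → k ⊓ (12 ∸ k) })
  where
  layerOf : Fin 18 → ℕ
  layerOf i = toℕ (proj₁ (enc i))

opaque
  D23-lip : ∀ u w v → adj W23 u w ≡ true → D23 u v ≤ suc (D23 w v)
  D23-lip = from-yes (all? λ u → all? λ w → all? λ v → (adj W23 u w ≟ᵇ true) →-dec (D23 u v ≤? suc (D23 w v)))

  D23-step : ∀ u v → u ≡ v ⊎ ∃ λ w → adj W23 u w ≡ true × D23 u v ≡ suc (D23 w v)
  D23-step = from-yes (all? λ u → all? λ v → (u ≟ v) ⊎-dec any? λ w → (adj W23 u w ≟ᵇ true) ×-dec (D23 u v ≟ℕ suc (D23 w v)))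

opaque
  W23-dist : ∀ u v → dist W23 u v ≡ D23 u v
  W23-dist = dist-char W23 D23 (from-yes (all? λ u → D23 u u ≟ℕ 0)) D23-lip D23-step

opaque
  W23-connected : Connected W23
  W23-connected u v = go (D23 u v) u refl
    where
    go : ∀ k u → D23 u v ≡ k → WalkIn W23 (λ _ → ⊤) u v
    go k u eq with D23-step u v
    ... | inj₁ refl = here tt
    go zero u eq | inj₂ (w , e , h) = contradiction (trans (sym eq) h) λ ()
    go (suc k) u eq | inj₂ (w , e , h) = step tt e (go k w (suc-injective (trans (sym h) eq)))

opaque
  W23-balanced : DistanceBalanced W23
  W23-balanced u v e = trans (card u v) (trans (balanced u v e) (sym (card v u)))
    where
    closer : ∀ u v → Decidable (λ z → T (D23 u z <ᵇ D23 v z))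
    closer u v z = T? (D23 u z <ᵇ D23 v z)

    card : ∀ u v → cardW W23 u v ≡ count (closer u v)
    card u v = count-cong (λ z → T? (dist W23 u z <ᵇ dist W23 v z)) (closer u v)
      (λ z → subst₂ (λ x y → T (x <ᵇ y)) (W23-dist u z) (W23-dist v z))
      (λ z → subst₂ (λ x y → T (x <ᵇ y)) (sym (W23-dist u z)) (sym (W23-dist v z)))

    balanced : ∀ u v → adj W23 u v ≡ true → count (closer u v) ≡ count (closer v u)
    balanced = from-yes (all? λ u → all? λ v → (adj W23 u v ≟ᵇ true) →-dec (count (closer u v) ≟ℕ count (closer v u)))

W23-bipartite : Bipartite W23
W23-bipartite = (λ i → par (toℕ (proj₁ (enc i)))) ,
  from-yes (all? λ u → all? λ v → (adj W23 u v ≟ᵇ true) →-dec ¬? (par (toℕ (proj₁ (enc u))) ≟ᵇ par (toℕ (proj₁ (enc v)))))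

-- Vertex 0 has the three neighbours 17, 1 and 2, one more than a cycle allows.
W23-not-cycle : ¬ IsCycle W23
W23-not-cycle (_ , e , iso) = case CycAdj-pigeonhole (Equivalence.to (iso 0F 17F) refl)
    (Equivalence.to (iso 0F 1F) refl) (Equivalence.to (iso 0F 2F) refl) of λ
    { (inj₁ eq) → contradiction (inj eq) λ () ; (inj₂ (inj₁ eq)) → contradiction (inj eq) λ ()
    ; (inj₂ (inj₂ eq)) → contradiction (inj eq) λ () }
  where
  inj : ∀ {x y} → Inverse.to e x ≡ Inverse.to e y → x ≡ y
  inj eq = trans (sym (Inverse.strictlyInverseʳ e _)) (trans (cong (Inverse.from e) eq) (Inverse.strictlyInverseʳ e _))

-- The inner vertices of one brick, which 0 and 5 separate from the others.
Brick₀ : Fin 18 → Set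
Brick₀ i = T ((0 <ᵇ toℕ i) ∧ (toℕ i <ᵇ 5))

Brick₀? : Decidable Brick₀
Brick₀? i = T? ((0 <ᵇ toℕ i) ∧ (toℕ i <ᵇ 5))

opaque
  Brick₀-closed : ∀ u w → Brick₀ u → adj W23 u w ≡ true → w ≡ 0F ⊎ w ≡ 5F ⊎ Brick₀ w
  Brick₀-closed = from-yes (all? λ u → all? λ w →
    Brick₀? u →-dec (adj W23 u w ≟ᵇ true) →-dec ((w ≟ 0F) ⊎-dec (w ≟ 5F) ⊎-dec Brick₀? w))

W23-not-3-connected : ¬ ThreeConnected W23
W23-not-3-connected (_ , _ , conn) = trapped (conn 0F 5F 1F 6F (λ ()) (λ ()) (λ ()) (λ ())) tt
  where
  start : ∀ {ok u v} → WalkIn W23 ok u v → ok u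
  start (here o) = o
  start (step o _ _) = o

  trapped : ∀ {u v} → WalkIn W23 (λ x → (x ≢ 0F) × (x ≢ 5F)) u v → Brick₀ u → Brick₀ v
  trapped (here _) h = h
  trapped {u} (step {w = w} _ e p) h with Brick₀-closed u w h e
  ... | inj₁ eq = contradiction eq (proj₁ (start p))
  ... | inj₂ (inj₁ eq) = contradiction eq (proj₂ (start p))
  ... | inj₂ (inj₂ h′) = trapped p h′

W23-admissible : Admissible W23
W23-admissible = W23-connected , W23-bipartite , W23-balanced , W23-not-cycle , W23-not-3-connected

-- From admissibility to the classification.

1≤⇒suc : ∀ {k} → 1 ≤ k → ∃ λ j → k ≡ suc j
1≤⇒suc (s≤s _) = _ , refl

distinct-pair : ∀ {n} → 3 ≤ n → ∃ λ (u : Fin n) → ∃ λ v → u ≢ v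
distinct-pair (s≤s (s≤s _)) = 0F , 1F , λ ()

double-injective : ∀ {x y} → x + x ≡ y + y → x ≡ y
double-injective {x} {y} eq with <-cmp x y
... | tri< lt _ _ = contradiction eq (<⇒≢ (+-mono-< lt lt))
... | tri≈ _ x≡y _ = x≡y
... | tri> _ _ gt = contradiction (sym eq) (<⇒≢ (+-mono-< gt gt))

module _ {n : ℕ} (G : Graph n) (conn : Connected G) (bip : Bipartite G) (db : DistanceBalanced G) where
  open BipartiteMetric G conn bip

  opaque
    -- In a bipartite graph no vertex is equidistant from the ends of an edge.
    cardW-sum : ∀ {u v} → Adj u v → cardW G u v + cardW G v u ≡ n
    cardW-sum {u} {v} e = trans (sym (count-≡-∪ univ? (closer u v) (closer v u) split _ _
        (λ z x y → <-asym (<ᵇ⇒< (dist G u z) _ x) (<ᵇ⇒< (dist G v z) _ y)))) (count-all univ? _)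
      where
      univ? : Decidable {A = V} (λ _ → ⊤)
      univ? _ = yes tt

      closer : ∀ u v → Decidable (λ z → T (dist G u z <ᵇ dist G v z))
      closer u v z = T? (dist G u z <ᵇ dist G v z)

      split : ∀ z → ⊤ → T (dist G u z <ᵇ dist G v z) ⊎ T (dist G v z <ᵇ dist G u z)
      split z _ with <-cmp (dist G u z) (dist G v z)
      ... | tri< lt _ _ = inj₁ (<⇒<ᵇ lt)
      ... | tri> _ _ gt = inj₂ (<⇒<ᵇ gt)
      ... | tri≈ _ eq _ = contradiction
        (trans (d-sym z u) (trans (d≡dist u z) (trans eq (trans (sym (d≡dist v z)) (d-sym v z))))) (adj-d-≢ z e)

  opaque
    -- Balance makes both sets of an edge equal to half of the vertices; m is read off one edge,
    -- which connectedness and two distinct vertices supply.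
    halves : 3 ≤ n → ∃ λ m → n ≡ m + m × (∀ u v → adj G u v ≡ true → cardW G u v ≡ m)
    halves 3≤n with u₀ , v₀ , neq ← distinct-pair 3≤n with w , e , _ ← d-pred u₀ v₀ (proj₂ (1≤⇒suc (d-pos neq))) =
        cardW G v₀ w , n≡ , λ u v f → double-injective (trans (twice f) n≡)
      where
      twice : ∀ {u v} → Adj u v → cardW G u v + cardW G u v ≡ n
      twice {u} {v} f = trans (cong (cardW G u v +_) (db u v f)) (cardW-sum f)

      n≡ : n ≡ cardW G v₀ w + cardW G v₀ w
      n≡ = sym (twice e)

opaque
  -- The bound `3 ≤ n` sets aside the connected graphs on at most two vertices, which satisfy
  -- `Admissible` trivially; it gives m ≥ 2, as the degree argument requires.
  classify : ∀ {n} (G : Graph n) → 3 ≤ n → Admissible G → n ≤ 18 →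
    n ≡ 18 × Layout G × (∀ {x u v} → u ≢ x → v ≢ x → (∀ w → adj G x w ≡ true → w ≡ u ⊎ w ≡ v) → ⊥)
  classify {n} G 3≤n (conn , bip , db , ¬cycle , ¬3c) n≤18 with m , n≡m+m , half ← halves G conn bip db 3≤n =
      order-18 m≤9 M , layout m≤9 M , degree-≥3
    where
    2≤m : 2 ≤ m
    2≤m = ≰⇒> λ m≤1 → <⇒≱ 3≤n (subst (_≤ 2) (sym n≡m+m) (+-mono-≤ m≤1 m≤1))

    m≤9 : m ≤ 9
    m≤9 = ≮⇒≥ λ 9<m → <⇒≱ (+-mono-< 9<m 9<m) (subst (_≤ 18) n≡m+m n≤18)

    open Balanced G conn bip m n≡m+m half
    open NonCycle ¬cycle 2≤m

    M : MinSide
    M = minSide (SomeSide.side (¬3-connected⇒side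
          (subst (4 ≤_) (sym n≡m+m) (+-mono-≤ 2≤m 2≤m)) ¬3c))

theorem3p8 : ((n : ℕ) (G : Graph n) → 3 ≤ n → Admissible G → 18 ≤ n)
    × Σ (Graph 18) (λ G → Admissible G × IsoTo G W23V W23Adj)
    × ((G : Graph 18) → Admissible G → IsoTo G W23V W23Adj)
theorem3p8 = lower-bound , (W23 , W23-admissible , W23-iso) , unique
  where
  lower-bound : (n : ℕ) (G : Graph n) → 3 ≤ n → Admissible G → 18 ≤ n
  lower-bound n G 3≤n adm = ≮⇒≥ λ n<18 → <⇒≢ n<18 (proj₁ (classify G 3≤n adm (<⇒≤ n<18)))

  unique : (G : Graph 18) → Admissible G → IsoTo G W23V W23Adj
  unique G adm with _ , L , deg ← classify G (s≤s (s≤s (s≤s z≤n))) adm ≤-refl = layout⇒iso G L deg
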